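{- For every integer $\Delta\geq 3$ there exist $c,n_0>0$ such that for every $n\geq n_0$ with $\Delta n$ even, if $G_{n,\Delta}$ is a graph chosen uniformly at random among all $\Delta$-regular graphs on the vertex set $[n]$, then $$\mathbb{P}(G_{n,\Delta}\text{ has a frozen }(\Delta+1)\text{ -colouring})\leq e^{ -cn}.$$
   Context: All graphs are finite, simple and labeled, with vertex set $[n]=\{1,\dots,n\}$. A (proper) $k$-colouring of $G$ is a function $\alpha:V(G)\to[k]$ with $\alpha(x)\neq\alpha(y)$ for every edge $xy$. For $G$ of maximum degree $\Delta$, a proper $(\Delta+1)$-colouring of $G$ is frozen if for every vertex $v$ all $\Delta+1$ colours appear in the closed neighbourhood $N[v]=N(v)\cup\{v\}$. -}

module Defs where

import Algebra.Definitions.RawSemiring as RawSemiring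
open import Data.Bool.Base using (true; false)
open import Data.Fin.Base using (Fin; finToFun; funToFin)
import Data.Fin.Properties as Fin
open import Data.Fin.Subset using (Subset; _∈_; _∉_; _∪_; ⁅_⁆; ∣_∣)
open import Data.Fin.Subset.Properties using (_∈?_)
import Data.Integer.Base as ℤ
open import Data.List.Base using (List; []; _∷_; length; filter; cartesianProductWith)
import Data.List.Membership.Propositional as List
import Data.List.Membership.Propositional.Properties as List
open import Data.List.Relation.Unary.All using ([]; _∷_)
open import Data.List.Relation.Unary.Any using (here; there)
open import Data.List.Relation.Unary.AllPairs using ([]; _∷_)
open import Data.List.Relation.Unary.Unique.Propositional using (Unique)
import Data.List.Relation.Unary.Unique.Propositional.Properties as Unique
open import Data.Nat.Base using (ℕ; zero; suc)
import Data.Nat.Base as ℕ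
import Data.Nat.Properties as ℕ
open import Data.Product.Base using (_×_; _,_; ∃-syntax)
open import Data.Rational.Base
  using (ℚ; 0ℚ; 1ℚ; _+_; _*_; _/_; _≤_; _<_; +-*-rawSemiring)
open import Data.Vec.Base as Vec using (Vec; lookup)
open import Data.Vec.Properties using (∷-injective)
open import Function.Bundles using (_⇔_; mk⇔)
open import Level using (Level)
open import Relation.Binary.PropositionalEquality
  using (_≡_; _≢_; _≗_; refl; sym; trans)
open import Relation.Nullary.Decidable
  using (map′; ¬?; _×-dec_; _→-dec_)
open import Relation.Unary using (Pred; Decidable)

open RawSemiring +-*-rawSemiring using (_^_)

private
  variable
    a p : Level
    A : Set a
    n k : ℕ

-- Labelled graphs on Fin n are given by the neighbourhoods of their vertices,
-- as vectors so that two graphs with the same edges are propositionally equal.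

Neighbourhoods : ℕ → Set
Neighbourhoods n = Vec (Subset n) n

N : Neighbourhoods n → Fin n → Subset n
N G v = lookup G v

N[_] : Neighbourhoods n → Fin n → Subset n
N[ G ] v = N G v ∪ ⁅ v ⁆

IsSimpleGraph : Neighbourhoods n → Set
IsSimpleGraph G = (∀ x → x ∉ N G x) × (∀ x y → y ∈ N G x → x ∈ N G y)

degree : Neighbourhoods n → Fin n → ℕ
degree G v = ∣ N G v ∣

IsRegularGraph : ℕ → Neighbourhoods n → Set
IsRegularGraph Δ G = IsSimpleGraph G × (∀ v → degree G v ≡ Δ)

IsProper : Neighbourhoods n → (Fin n → Fin k) → Set
IsProper G α = ∀ x y → y ∈ N G x → α x ≢ α y

IsFrozen : Neighbourhoods n → (Fin n → Fin k) → Set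
IsFrozen G α = IsProper G α × (∀ v c → ∃[ u ] (u ∈ N[ G ] v × α u ≡ c))

HasFrozenColouring : (k : ℕ) → Neighbourhoods n → Set
HasFrozenColouring {n} k G = ∃[ α ] IsFrozen {n} {k} G α

isSimpleGraph? : Decidable (IsSimpleGraph {n})
isSimpleGraph? G =
  Fin.all? (λ x → ¬? (x ∈? N G x)) ×-dec
  Fin.all? (λ x → Fin.all? λ y → (y ∈? N G x) →-dec (x ∈? N G y))

isRegularGraph? : (Δ : ℕ) → Decidable (IsRegularGraph {n} Δ)
isRegularGraph? Δ G =
  isSimpleGraph? G ×-dec Fin.all? (λ v → degree G v ℕ.≟ Δ)

isFrozen? : (G : Neighbourhoods n) → Decidable (IsFrozen {n} {k} G)
isFrozen? G α =
  Fin.all? (λ x → Fin.all? λ y → (y ∈? N G x) →-dec ¬? (α x Fin.≟ α y)) ×-dec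
  Fin.all? (λ v → Fin.all? λ c → Fin.any? λ u → (u ∈? N[ G ] v) ×-dec (α u Fin.≟ c))

isFrozen-resp-≗ : (G : Neighbourhoods n) {α β : Fin n → Fin k} →
                  α ≗ β → IsFrozen G α → IsFrozen G β
isFrozen-resp-≗ G α≗β (proper , full) =
  (λ x y y∈Nx βx≡βy →
    proper x y y∈Nx (trans (α≗β x) (trans βx≡βy (sym (α≗β y))))) ,
  (λ v c → let (u , u∈ , αu≡c) = full v c in
    u , u∈ , trans (sym (α≗β u)) αu≡c)

hasFrozenColouring? : (k : ℕ) → Decidable (HasFrozenColouring {n} k)
hasFrozenColouring? k G =
  map′ (λ (i , frozen) → finToFun i , frozen)
       (λ (α , frozen) → funToFin α ,
          isFrozen-resp-≗ G (λ v → sym (Fin.finToFun-funToFin α v)) frozen)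
       (Fin.any? (λ i → isFrozen? G (finToFun i)))

vectorsOver : List A → (n : ℕ) → List (Vec A n)
vectorsOver xs zero    = Vec.[] ∷ []
vectorsOver xs (suc n) = cartesianProductWith Vec._∷_ xs (vectorsOver xs n)

∈-vectorsOver : {xs : List A} → (∀ x → x List.∈ xs) →
                (v : Vec A n) → v List.∈ vectorsOver xs n
∈-vectorsOver full Vec.[]       = here refl
∈-vectorsOver full (x Vec.∷ v) =
  List.∈-cartesianProductWith⁺ Vec._∷_ (full x) (∈-vectorsOver full v)

vectorsOver-unique : {xs : List A} → Unique xs → ∀ n → Unique (vectorsOver xs n)
vectorsOver-unique uniq zero    = [] ∷ []
vectorsOver-unique uniq (suc n) =
  Unique.cartesianProductWith⁺ Vec._∷_ ∷-injective uniq (vectorsOver-unique uniq n)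

subsets : (n : ℕ) → List (Subset n)
subsets = vectorsOver (true ∷ false ∷ [])

regularGraphs : (Δ n : ℕ) → List (Neighbourhoods n)
regularGraphs Δ n = filter (isRegularGraph? Δ) (vectorsOver (subsets n) n)

∈-subsets : (s : Subset n) → s List.∈ subsets n
∈-subsets = ∈-vectorsOver λ { true → here refl ; false → there (here refl) }

subsets-unique : ∀ n → Unique (subsets n)
subsets-unique = vectorsOver-unique (((λ ()) ∷ []) ∷ [] ∷ [])

∈-regularGraphs : (Δ : ℕ) (G : Neighbourhoods n) →
                  G List.∈ regularGraphs Δ n ⇔ IsRegularGraph Δ G
∈-regularGraphs {n} Δ G = mk⇔
  (λ G∈ → let (_ , reg) = List.∈-filter⁻ (isRegularGraph? Δ) {xs = vectorsOver (subsets n) n} G∈ in reg)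
  (List.∈-filter⁺ (isRegularGraph? Δ) (∈-vectorsOver ∈-subsets G))

regularGraphs-unique : ∀ Δ n → Unique (regularGraphs Δ n)
regularGraphs-unique Δ n =
  Unique.filter⁺ (isRegularGraph? Δ) (vectorsOver-unique (subsets-unique n) n)

-- Probability that a uniformly random entry of the list satisfies the
-- predicate, with the convention 0/0 = 0 for the empty list.

ℙ[_over_] : {P : Pred A p} → Decidable P → List A → ℚ
ℙ[ P? over []          ] = 0ℚ
ℙ[ P? over xs@(_ ∷ _) ] = ℤ.+ length (filter P? xs) / length xs

fromℕ : ℕ → ℚ
fromℕ m = ℤ.+ m / 1

-- For a convergent sequence s of rationals, p ≤lim s says that p is at most
-- the real number lim s.

infix 4 _≤lim_ _≤exp_

_≤lim_ : ℚ → (ℕ → ℚ) → Set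
p ≤lim s = ∀ ε → 0ℚ < ε → ∃[ K ] (∀ k → K ℕ.≤ k → p ≤ s k + ε)

-- e^x is the limit of (1 + x/m)^m, taken over m = suc k ≥ 1.

expSeq : ℚ → ℕ → ℚ
expSeq x k = (1ℚ + x * (ℤ.+ 1 / suc k)) ^ suc k

_≤exp_ : ℚ → ℚ → Set
p ≤exp x = p ≤lim expSeq x

{-# OPTIONS --safe #-}

module Submission where

open import Defs
import Algebra.Bundles
import Algebra.Properties.Semiring.Exp as Exp
open import Data.Bool.Base using (true; false)
open import Data.Empty using (⊥)
open import Data.Fin.Base using (Fin; zero; suc; combine; quotient; remainder) renaming (_<_ to _<ᶠ_)
import Data.Fin.Properties as Fin
open import Data.Fin.Subset using (Subset; ∣_∣) renaming (_∈_ to _∈ˢ_)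
open import Data.Fin.Subset.Properties using (⊆-antisym; x∈p∪q⁻; x∈⁅y⁆⇒x≡y) renaming (_∈?_ to _∈ˢ?_)
import Data.Integer.Base as ℤ
import Data.Integer.Properties as ℤ
open import Data.List.Base
  using (List; []; _∷_; [_]; _++_; map; length; filter; concatMap; cartesianProduct; cartesianProductWith; allFin)
import Data.List.Membership.DecPropositional as DecMembership
open import Data.List.Membership.Propositional using (_∈_; _∉_)
open import Data.List.Membership.Propositional.Properties
open import Data.List.Properties
  using (length-++; length-map; length-++-sucʳ; ∷-injective; filter-notAll; map-injective; length-tabulate; length-filter)
open import Data.List.Relation.Unary.All as All using (All; []; _∷_)
import Data.List.Relation.Unary.All.Properties as All
open import Data.List.Relation.Unary.AllPairs as AllPairs using (AllPairs; []; _∷_)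
import Data.List.Relation.Unary.AllPairs.Properties as AllPairs
open import Data.List.Relation.Unary.Any as Any using (here; there)
open import Data.List.Relation.Unary.Unique.Propositional using (Unique)
import Data.List.Relation.Unary.Unique.Propositional.Properties as Unique
open import Data.Nat.Base as ℕ using (ℕ; zero; suc; _+_; _*_; _∸_; _^_; _!; _≤_; _<_; z≤n; s≤s)
open import Data.Nat.Divisibility using (_∣_)
open import Data.Nat.DivMod using (m≡m%n+[m/n]*n; m%n<n; m/n*n≤m)
open import Data.Nat.Properties renaming (_≟_ to _≟ᴺ_) hiding (<-cmp)
open import Data.Nat.Solver using (module +-*-Solver)
open import Data.Product.Base as Product using (Σ; _×_; _,_; proj₁; proj₂; ∃-syntax; uncurry)
open import Data.Product.Properties using (≡-dec)
open import Data.Rational.Base as ℚ using (ℚ; 0ℚ; 1ℚ; ½)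
import Data.Rational.Properties as ℚ
import Data.Rational.Solver as ℚ
import Data.Rational.Unnormalised.Base as ℚᵘ
import Data.Rational.Unnormalised.Properties as ℚᵘ
open import Data.Sum.Base using (_⊎_; inj₁; inj₂; swap)
import Data.Vec.Base as Vec
import Data.Vec.Properties as Vec
open import Function.Base using (_∘_; id)
open import Function.Bundles using (Equivalence)
open import Level using (Level)
open import Relation.Binary.Core using (Rel)
import Relation.Binary.Definitions as Binary
open import Relation.Binary.PropositionalEquality
  using (_≡_; _≢_; refl; sym; trans; cong; cong₂; subst; subst₂; module ≡-Reasoning)
open import Relation.Nullary using (¬_; yes; no; contradiction)
open import Relation.Nullary.Decidable using (does; ¬?; _×-dec_; _⊎-dec_; dec-true; decidable-stable)
open import Relation.Unary using (Pred; Decidable)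

open Binary using (tri<; tri≈; tri>)
open +-*-Solver using (solve; _:=_; _:+_; _:*_; con)

-- Write k = Δ + 1. In a frozen colouring the neighbourhood of a vertex has one
-- vertex of each other colour, so n = k m, the k colour classes have size m, and
-- any two of them are joined by a perfect matching: at most
-- kⁿ (m!)^(k Δ / 2) graphs are frozen.
--
-- The number of all Δ-regular graphs grows faster. Deleting Δ pairwise disjoint
-- arcs (xᵢ , yᵢ) and joining one new vertex to all xᵢ and another one to all yᵢ
-- gives a regular graph on n + 2 vertices, from which the arcs are recovered once
-- the two new neighbourhoods are ordered. Hence that number is multiplied by at
-- least (Δ n - O(1))^Δ / (Δ!)² from n to n + 2, and since 3 (k!)² ≤ (k Δ)^Δ, each
-- step from m to m + 2 with m large divides the ratio of the two bounds by at
-- least 4.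

-- Only quotients of successive counts are compared, so the argument runs without Stirling's formula
-- and without an asymptotic count of regular graphs. Passing from m to m + 2 adds 2 k vertices,
-- hence k insertions, and multiplies the bound on frozen graphs by at most (k² (m + 2)^Δ)^k. Up to
-- the O(1), one insertion therefore gains (k Δ)^Δ / (k!)². This quotient is exactly 1 for Δ = 2 and
-- exactly 3 for Δ = 3, the first case with something to gain. Of the factor 3 a part 3/2 pays for
-- the O(1); the 2 that is left gives 2^k ≥ 4 per step. Two vertices are inserted at once because a
-- single one would have to absorb the ends of Δ / 2 deleted edges, which fails for odd Δ. So m also
-- moves by two, whatever the parity of k, and both parities of m need a starting graph; disjoint
-- copies of the complete graph on k vertices provide it.

private
  variable
    a b ℓ : Level
    A B : Set a
    x : A
    xs ys : List A
    n : ℕ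

-- Counting with lists

-- An injection in relational form: the encodings below depend on proofs, such as frozenness, which
-- a relation can carry along. Removing the image of the head from `ys` leaves the images of the
-- other entries in place.
injection⇒length≤ : (R : A → B → Set ℓ) → (∀ {x x′ y} → R x y → R x′ y → x ≡ x′) →
                    Unique xs → (∀ {x} → x ∈ xs → ∃[ y ] (y ∈ ys × R x y)) →
                    length xs ≤ length ys
injection⇒length≤ R inj [] total = z≤n
injection⇒length≤ {xs = x ∷ xs} R inj (x∉xs ∷ xs!) total
  with y , y∈ys , Rxy ← total (here refl)
  with us , vs , refl ← ∈-∃++ y∈ys =
  subst (suc (length xs) ≤_) (sym (length-++-sucʳ us y vs))
    (s≤s (injection⇒length≤ R inj xs! total′))
  where
  total′ : ∀ {x′} → x′ ∈ xs → ∃[ y′ ] (y′ ∈ us ++ vs × R x′ y′)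
  total′ x′∈xs with y′ , y′∈ys , Rx′y′ ← total (there x′∈xs) with ∈-++⁻ us y′∈ys
  ... | inj₁ y′∈us = y′ , ∈-++⁺ˡ y′∈us , Rx′y′
  ... | inj₂ (here refl) = contradiction (inj Rxy Rx′y′) (All.lookup x∉xs x′∈xs)
  ... | inj₂ (there y′∈vs) = y′ , ∈-++⁺ʳ us y′∈vs , Rx′y′

⊆⇒length≤ : Unique xs → (∀ {x} → x ∈ xs → x ∈ ys) → length xs ≤ length ys
⊆⇒length≤ xs! xs⊆ys =
  injection⇒length≤ _≡_ (λ p q → trans p (sym q)) xs! (λ {x} x∈xs → x , xs⊆ys x∈xs , refl)

-- If two distinct entries had one image, either could be dropped from `xs` and `ys` would still be
-- covered, by fewer entries than it has itself.
covering⇒injective : (f : A → B) → Unique ys → (∀ {y} → y ∈ ys → ∃[ x ] (x ∈ xs × f x ≡ y)) →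
                     length xs ≤ length ys → ∀ {x x′} → x ∈ xs → x′ ∈ xs → f x ≡ f x′ →
                     Binary.DecidableEquality A → x ≡ x′
covering⇒injective {ys = ys} {xs = xs} f ys! cover ∣xs∣≤∣ys∣ {x} {x′} x∈xs x′∈xs fx≡fx′ _≟_
  with x ≟ x′
... | yes x≡x′ = x≡x′
... | no x≢x′ with us , vs , refl ← ∈-∃++ x′∈xs =
  contradiction (≤-trans (s≤s smaller) (subst (_≤ length ys) (length-++-sucʳ us x′ vs) ∣xs∣≤∣ys∣)) 1+n≰n
  where
  remove : ∀ {z} → z ∈ us ++ x′ ∷ vs → z ≢ x′ → z ∈ us ++ vs
  remove z∈ z≢x′ with ∈-++⁻ us z∈
  ... | inj₁ z∈us = ∈-++⁺ˡ z∈us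
  ... | inj₂ (here z≡x′) = contradiction z≡x′ z≢x′
  ... | inj₂ (there z∈vs) = ∈-++⁺ʳ us z∈vs
  cover′ : ∀ {y} → y ∈ ys → ∃[ z ] (z ∈ us ++ vs × f z ≡ y)
  cover′ y∈ys with z , z∈ , fz≡y ← cover y∈ys with z ≟ x′
  ... | yes refl = x , remove x∈xs x≢x′ , trans fx≡fx′ fz≡y
  ... | no z≢x′ = z , remove z∈ z≢x′ , fz≡y
  smaller : length ys ≤ length (us ++ vs)
  smaller = injection⇒length≤ (λ y z → f z ≡ y) (λ p q → trans (sym p) q) ys! cover′

length-remove : (_≟_ : Binary.DecidableEquality A) → Unique xs → x ∈ xs →
                suc (length (filter (λ y → ¬? (y ≟ x)) xs)) ≡ length xs
length-remove {xs = xs} {x = x} _≟_ xs! x∈xs = ≤-antisym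
  (⊆⇒length≤ (All.tabulate (λ y∈ x≡y → proj₂ (∈-filter⁻ ≢x? {xs = xs} y∈) (sym x≡y)) ∷ Unique.filter⁺ ≢x? xs!)
    λ { (here refl) → x∈xs ; (there y∈) → proj₁ (∈-filter⁻ ≢x? {xs = xs} y∈) })
  (⊆⇒length≤ xs! cases)
  where
  ≢x? : Decidable (_≢ x)
  ≢x? y = ¬? (y ≟ x)
  cases : ∀ {y} → y ∈ xs → y ∈ x ∷ filter ≢x? xs
  cases {y} y∈xs with y ≟ x
  ... | yes y≡x = here y≡x
  ... | no y≢x = there (∈-filter⁺ ≢x? y∈xs y≢x)

module _ {A : Set a} {B : Set b} where

  Σ-list : List A → (A → List B) → List (A × B)
  Σ-list xs f = concatMap (λ x → map (x ,_) (f x)) xs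

  ∈-Σ-list⁺ : ∀ {xs x y} {f : A → List B} → x ∈ xs → y ∈ f x → (x , y) ∈ Σ-list xs f
  ∈-Σ-list⁺ (here refl) y∈ = ∈-++⁺ˡ (∈-map⁺ (_ ,_) y∈)
  ∈-Σ-list⁺ {xs = z ∷ _} {f = f} (there x∈) y∈ = ∈-++⁺ʳ (map (z ,_) (f z)) (∈-Σ-list⁺ x∈ y∈)

  ∈-Σ-list⁻ : ∀ xs {x y} {f : A → List B} → (x , y) ∈ Σ-list xs f → x ∈ xs × y ∈ f x
  ∈-Σ-list⁻ (z ∷ xs) {f = f} p with ∈-++⁻ (map (z ,_) (f z)) p
  ... | inj₁ q with _ , y∈ , refl ← ∈-map⁻ (z ,_) q = here refl , y∈
  ... | inj₂ q with x∈ , y∈ ← ∈-Σ-list⁻ xs q = there x∈ , y∈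

  Σ-list-unique : ∀ {xs} {f : A → List B} → Unique xs → (∀ x → Unique (f x)) →
                  Unique (Σ-list xs f)
  Σ-list-unique [] f! = []
  Σ-list-unique {x ∷ xs} {f} (x∉xs ∷ xs!) f! =
    Unique.++⁺ (Unique.map⁺ (λ { refl → refl }) (f! x)) (Σ-list-unique xs! f!)
      (λ (p , q) → let (_ , _ , eq) = ∈-map⁻ (x ,_) p
                       (x′∈xs , _) = ∈-Σ-list⁻ xs q
                   in All.lookup x∉xs x′∈xs (sym (cong proj₁ eq)))

  length-Σ-list-∷ : ∀ x xs (f : A → List B) →
                    length (Σ-list (x ∷ xs) f) ≡ length (f x) + length (Σ-list xs f)
  length-Σ-list-∷ x xs f =
    trans (length-++ (map (x ,_) (f x))) (cong (_+ _) (length-map (x ,_) (f x)))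

  length-Σ-list-≤ : ∀ xs (f : A → List B) {K} → (∀ {x} → x ∈ xs → length (f x) ≤ K) →
                    length (Σ-list xs f) ≤ length xs * K
  length-Σ-list-≤ [] f bound = z≤n
  length-Σ-list-≤ (x ∷ xs) f bound rewrite length-Σ-list-∷ x xs f =
    +-mono-≤ (bound (here refl)) (length-Σ-list-≤ xs f (bound ∘ there))

  length-Σ-list-≥ : ∀ xs (f : A → List B) {K} → (∀ {x} → x ∈ xs → K ≤ length (f x)) →
                    length xs * K ≤ length (Σ-list xs f)
  length-Σ-list-≥ [] f bound = z≤n
  length-Σ-list-≥ (x ∷ xs) f bound rewrite length-Σ-list-∷ x xs f =
    +-mono-≤ (bound (here refl)) (length-Σ-list-≥ xs f (bound ∘ there))

-- Sequences with a pairwise condition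

module _ {A : Set a} {R : Rel A ℓ} (R? : Binary.Decidable R) where

  -- One definition serves three counts: tuples of disjoint arcs (`R` is `_⋈_`), orderings of a
  -- neighbourhood, and matchings into a colour class (`R` is `_≢_` in both).
  chains : ℕ → List A → List (List A)
  chains zero    xs = [ [] ]
  chains (suc r) xs = map (uncurry _∷_) (Σ-list xs λ x → chains r (filter (R? x) xs))

  private
    rest : ℕ → List A → A → List (List A)
    rest r xs x = chains r (filter (R? x) xs)

    length-chains-suc : ∀ r xs → length (chains (suc r) xs) ≡ length (Σ-list xs (rest r xs))
    length-chains-suc r xs = length-map (uncurry _∷_) (Σ-list xs (rest r xs))

  ∈-chains⁺ : ∀ {xs ys} → All (_∈ xs) ys → AllPairs R ys → ys ∈ chains (length ys) xs
  ∈-chains⁺ [] [] = here refl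
  ∈-chains⁺ (y∈ ∷ ys⊆) (Ry ∷ Rys) =
    ∈-map⁺ (uncurry _∷_) (∈-Σ-list⁺ y∈ (∈-chains⁺ (All.zipWith (uncurry (∈-filter⁺ (R? _))) (ys⊆ , Ry)) Rys))

  ∈-chains⁻ : ∀ r {xs ys} → ys ∈ chains r xs → All (_∈ xs) ys × AllPairs R ys × length ys ≡ r
  ∈-chains⁻ zero (here refl) = [] , [] , refl
  ∈-chains⁻ (suc r) {xs} ys∈
    with (y , zs) , p , refl ← ∈-map⁻ (uncurry _∷_) ys∈
    with y∈ , zs∈ ← ∈-Σ-list⁻ xs p
    with zs⊆ , Rzs , eq ← ∈-chains⁻ r zs∈ =
    y∈ ∷ All.map (proj₁ ∘ ∈-filter⁻ (R? y) {xs = xs}) zs⊆ ,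
    All.map (proj₂ ∘ ∈-filter⁻ (R? y) {xs = xs}) zs⊆ ∷ Rzs ,
    cong suc eq

  chains-unique : ∀ r {xs} → Unique xs → Unique (chains r xs)
  chains-unique zero    xs! = [] ∷ []
  chains-unique (suc r) xs! =
    Unique.map⁺ (λ { {_ , _} {_ , _} refl → refl })
      (Σ-list-unique xs! (λ x → chains-unique r (Unique.filter⁺ (R? x) xs!)))

  -- By irreflexivity the chosen entry is itself filtered out, so each choice leaves at least one
  -- candidate fewer.
  length-chains-≤ : (∀ {x} → ¬ R x x) → ∀ r xs → length xs ≤ r → length (chains r xs) ≤ r !
  length-chains-≤ irrefl zero    xs ∣xs∣≤r = ≤-refl
  length-chains-≤ irrefl (suc r) xs ∣xs∣≤r = begin
    length (chains (suc r) xs)         ≡⟨ length-chains-suc r xs ⟩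
    length (Σ-list xs (rest r xs)) ≤⟨ length-Σ-list-≤ xs (rest r xs) (λ x∈xs → length-chains-≤ irrefl r _ (fewer x∈xs)) ⟩
    length xs * r !                ≤⟨ *-monoˡ-≤ (r !) ∣xs∣≤r ⟩
    suc r * r !                    ∎
    where
    open ≤-Reasoning
    fewer : ∀ {x} → x ∈ xs → length (filter (R? x) xs) ≤ r
    fewer {x} x∈xs = ≤-pred (≤-trans
      (filter-notAll (R? x) xs (Any.map (λ { refl → irrefl }) x∈xs)) ∣xs∣≤r)

  -- Greedy choice: each chosen entry rules out at most `D` others, so at least `K` candidates
  -- remain at each of the `r` choices.
  length-chains-≥ : ∀ {D K} (conflicts : A → List A) → (∀ x → length (conflicts x) ≤ D) →
                    ∀ r {xs} → Unique xs →
                    (∀ {x y} → x ∈ xs → y ∈ xs → ¬ R x y → y ∈ conflicts x) →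
                    K + r * D ≤ length xs → K ^ r ≤ length (chains r xs)
  length-chains-≥ {D} {K} conflicts few zero    xs! conflict large = ≤-refl
  length-chains-≥ {D} {K} conflicts few (suc r) {xs} xs! conflict large = begin
    K * K ^ r                      ≤⟨ *-monoˡ-≤ (K ^ r) (m+n≤o⇒m≤o K large) ⟩
    length xs * K ^ r              ≤⟨ length-Σ-list-≥ xs (rest r xs) many ⟩
    length (Σ-list xs (rest r xs)) ≡⟨ length-chains-suc r xs ⟨
    length (chains (suc r) xs)     ∎
    where
    open ≤-Reasoning
    split : ∀ {x} → x ∈ xs → length xs ≤ D + length (filter (R? x) xs)
    split {x} x∈xs = begin
      length xs                                     ≤⟨ ⊆⇒length≤ xs! cases ⟩
      length (conflicts x ++ filter (R? x) xs)      ≡⟨ length-++ (conflicts x) ⟩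
      length (conflicts x) + length (filter (R? x) xs) ≤⟨ +-monoˡ-≤ _ (few x) ⟩
      D + length (filter (R? x) xs)                 ∎
      where
      cases : ∀ {y} → y ∈ xs → y ∈ conflicts x ++ filter (R? x) xs
      cases {y} y∈xs with R? x y
      ... | yes Rxy = ∈-++⁺ʳ (conflicts x) (∈-filter⁺ (R? x) y∈xs Rxy)
      ... | no ¬Rxy = ∈-++⁺ˡ (conflict x∈xs y∈xs ¬Rxy)
    many : ∀ {x} → x ∈ xs → K ^ r ≤ length (chains r (filter (R? x) xs))
    many {x} x∈xs = length-chains-≥ conflicts few r (Unique.filter⁺ (R? x) xs!)
      (λ p q → conflict (proj₁ (∈-filter⁻ (R? x) p)) (proj₁ (∈-filter⁻ (R? x) q)))
      (+-cancelˡ-≤ D _ _ (begin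
        D + (K + r * D) ≡⟨ +-assoc D K _ ⟨
        D + K + r * D   ≡⟨ cong (_+ r * D) (+-comm D K) ⟩
        K + D + r * D   ≡⟨ +-assoc K D _ ⟩
        K + suc r * D   ≤⟨ large ⟩
        length xs       ≤⟨ split x∈xs ⟩
        D + length (filter (R? x) xs) ∎))

length-cartesianProductWith : ∀ {c} {C : Set c} (f : A → B → C) xs ys →
                              length (cartesianProductWith f xs ys) ≡ length xs * length ys
length-cartesianProductWith f []       ys = refl
length-cartesianProductWith f (x ∷ xs) ys = begin
  length (map (f x) ys ++ cartesianProductWith f xs ys)
    ≡⟨ length-++ (map (f x) ys) ⟩
  length (map (f x) ys) + length (cartesianProductWith f xs ys)
    ≡⟨ cong₂ _+_ (length-map (f x) ys) (length-cartesianProductWith f xs ys) ⟩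
  length ys + length xs * length ys ∎
  where open ≡-Reasoning

choices : List (List A) → List (List A)
choices []         = [ [] ]
choices (xs ∷ xss) = cartesianProductWith _∷_ xs (choices xss)

∈-choices⁺ : (f : A → B) (g : A → List B) → ∀ {xs} → (∀ {x} → x ∈ xs → f x ∈ g x) →
             map f xs ∈ choices (map g xs)
∈-choices⁺ f g {[]}     f∈g = here refl
∈-choices⁺ f g {x ∷ xs} f∈g =
  ∈-cartesianProductWith⁺ _∷_ (f∈g (here refl)) (∈-choices⁺ f g (f∈g ∘ there))

length-choices-≤ : (g : A → List B) → ∀ {K} xs → (∀ x → length (g x) ≤ K) →
                   length (choices (map g xs)) ≤ K ^ length xs
length-choices-≤ g []       bound = ≤-refl
length-choices-≤ g (x ∷ xs) bound = ≤-trans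
  (≤-reflexive (length-cartesianProductWith _∷_ (g x) (choices (map g xs))))
  (*-mono-≤ (bound x) (length-choices-≤ g xs bound))

-- Graphs as lists of neighbours

elements : Subset n → List (Fin n)
elements Vec.[]            = []
elements (true  Vec.∷ p) = zero ∷ map suc (elements p)
elements (false Vec.∷ p) = map suc (elements p)

∈-elements⁺ : ∀ {x} {p : Subset n} → x ∈ˢ p → x ∈ elements p
∈-elements⁺ {p = true  Vec.∷ p} Vec.here       = here refl
∈-elements⁺ {p = true  Vec.∷ p} (Vec.there x∈) = there (∈-map⁺ suc (∈-elements⁺ x∈))
∈-elements⁺ {p = false Vec.∷ p} (Vec.there x∈) = ∈-map⁺ suc (∈-elements⁺ x∈)

∈-elements⁻ : ∀ {x} (p : Subset n) → x ∈ elements p → x ∈ˢ p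
∈-elements⁻ (true  Vec.∷ p) (here refl) = Vec.here
∈-elements⁻ (true  Vec.∷ p) (there x∈) with _ , y∈ , refl ← ∈-map⁻ suc x∈ = Vec.there (∈-elements⁻ p y∈)
∈-elements⁻ (false Vec.∷ p) x∈ with _ , y∈ , refl ← ∈-map⁻ suc x∈ = Vec.there (∈-elements⁻ p y∈)

elements-unique : (p : Subset n) → Unique (elements p)
elements-unique Vec.[]          = []
elements-unique (true  Vec.∷ p) =
  All.map⁺ (All.universal (λ _ ()) (elements p)) ∷ Unique.map⁺ Fin.suc-injective (elements-unique p)
elements-unique (false Vec.∷ p) = Unique.map⁺ Fin.suc-injective (elements-unique p)

length-elements : (p : Subset n) → length (elements p) ≡ ∣ p ∣
length-elements Vec.[]          = refl
length-elements (true  Vec.∷ p) = cong suc (trans (length-map suc (elements p)) (length-elements p))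
length-elements (false Vec.∷ p) = trans (length-map suc (elements p)) (length-elements p)

_≢?_ : Binary.Decidable {A = Fin n} _≢_
x ≢? y = ¬? (x Fin.≟ y)

same-elements⇒length≡ : {A : Set a} {xs ys : List A} → Unique xs → Unique ys →
                        (∀ {x} → x ∈ xs → x ∈ ys) → (∀ {x} → x ∈ ys → x ∈ xs) → length xs ≡ length ys
same-elements⇒length≡ xs! ys! xs⊆ys ys⊆xs = ≤-antisym (⊆⇒length≤ xs! xs⊆ys) (⊆⇒length≤ ys! ys⊆xs)

toSubset : {P : Pred (Fin n) ℓ} → Decidable P → Subset n
toSubset P? = Vec.tabulate (does ∘ P?)

module _ {P : Pred (Fin n) ℓ} (P? : Decidable P) {x : Fin n} where

  ∈-toSubset⁺ : P x → x ∈ˢ toSubset P?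
  ∈-toSubset⁺ px = Vec.lookup⇒[]= x _ (trans (Vec.lookup∘tabulate (does ∘ P?) x) (dec-true (P? x) px))

  ∈-toSubset⁻ : x ∈ˢ toSubset P? → P x
  ∈-toSubset⁻ x∈ with P? x | trans (sym (Vec.lookup∘tabulate (does ∘ P?) x)) (Vec.[]=⇒lookup x∈)
  ... | yes px | _ = px

fromRelation : {E : Rel (Fin n) ℓ} → Binary.Decidable E → Neighbourhoods n
fromRelation E? = Vec.tabulate (λ x → toSubset (E? x))

module _ {n} {E : Rel (Fin n) ℓ} (E? : Binary.Decidable E) {x : Fin n} where

  ∈-N⁺ : ∀ {y} → E x y → y ∈ˢ N (fromRelation E?) x
  ∈-N⁺ Exy = subst (_ ∈ˢ_) (sym (Vec.lookup∘tabulate _ x)) (∈-toSubset⁺ (E? x) Exy)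

  ∈-N⁻ : ∀ {y} → y ∈ˢ N (fromRelation E?) x → E x y
  ∈-N⁻ y∈ = ∈-toSubset⁻ (E? x) (subst (_ ∈ˢ_) (Vec.lookup∘tabulate _ x) y∈)

  degree-fromRelation : ∀ {xs} → Unique xs → (∀ {y} → y ∈ xs → E x y) → (∀ {y} → E x y → y ∈ xs) →
                        degree (fromRelation E?) x ≡ length xs
  degree-fromRelation xs! sound complete = trans (sym (length-elements p))
    (same-elements⇒length≡ (elements-unique p) xs!
      (λ y∈ → complete (∈-N⁻ (∈-elements⁻ p y∈)))
      (λ y∈ → ∈-elements⁺ (∈-N⁺ (sound y∈))))
    where
    p : Subset n
    p = N (fromRelation E?) x

graph-ext : {G H : Neighbourhoods n} → (∀ {x y} → y ∈ˢ N G x → y ∈ˢ N H x) →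
            (∀ {x y} → y ∈ˢ N H x → y ∈ˢ N G x) → G ≡ H
graph-ext {G = G} {H} G⊆H H⊆G = begin
  G                 ≡⟨ Vec.tabulate∘lookup G ⟨
  Vec.tabulate (N G) ≡⟨ Vec.tabulate-cong (λ x → ⊆-antisym G⊆H H⊆G) ⟩
  Vec.tabulate (N H) ≡⟨ Vec.tabulate∘lookup H ⟩
  H                 ∎
  where open ≡-Reasoning

neighbours : Neighbourhoods n → Fin n → List (Fin n)
neighbours G x = elements (N G x)

length-neighbours : ∀ {Δ} (G : Neighbourhoods n) → IsRegularGraph Δ G →
                    ∀ x → length (neighbours G x) ≡ Δ
length-neighbours G (_ , regular) x = trans (length-elements (N G x)) (regular x)

Arc : ℕ → Set
Arc n = Fin n × Fin n

-- Every edge occurs in both orientations; the orientation of a selected arc decides which end is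
-- joined to which new vertex.
arcs : Neighbourhoods n → List (Arc n)
arcs G = Σ-list (allFin _) (neighbours G)

∈-arcs⁻ : (G : Neighbourhoods n) → ∀ {x y} → (x , y) ∈ arcs G → y ∈ˢ N G x
∈-arcs⁻ G p = ∈-elements⁻ _ (proj₂ (∈-Σ-list⁻ (allFin _) p))

arcs-unique : (G : Neighbourhoods n) → Unique (arcs G)
arcs-unique G = Σ-list-unique (Unique.allFin⁺ _) (λ x → elements-unique (N G x))

length-arcs-≥ : ∀ {Δ} (G : Neighbourhoods n) → IsRegularGraph Δ G → n * Δ ≤ length (arcs G)
length-arcs-≥ {n} {Δ} G regular =
  subst (λ m → m * Δ ≤ length (arcs G)) (length-tabulate {n = n} id)
    (length-Σ-list-≥ (allFin n) (neighbours G)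
      (λ {x} _ → ≤-reflexive (sym (length-neighbours G regular x))))

-- Insertion of two vertices

_⋈_ : Rel (Arc n) _
(x , y) ⋈ (x′ , y′) = (x ≢ x′ × x ≢ y′) × (y ≢ x′ × y ≢ y′)

_⋈?_ : Binary.Decidable (_⋈_ {n})
(x , y) ⋈? (x′ , y′) =
  (¬? (x Fin.≟ x′) ×-dec ¬? (x Fin.≟ y′)) ×-dec (¬? (y Fin.≟ x′) ×-dec ¬? (y Fin.≟ y′))

⋈-sym : {e e′ : Arc n} → e ⋈ e′ → e′ ⋈ e
⋈-sym ((a , b) , (c , d)) = (a ∘ sym , c ∘ sym) , (b ∘ sym , d ∘ sym)

-- The form in which disjointness is used: selected arcs that share an end coincide. `AllPairs`
-- relates entries in list order only, hence the appeal to `⋈-sym`.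
overlapping⇒≡ : {e e′ : Arc n} {s : List (Arc n)} → AllPairs _⋈_ s → e ∈ s → e′ ∈ s → ¬ (e ⋈ e′) → e ≡ e′
overlapping⇒≡ (_ ∷ s⋈) (here refl) (here refl) _   = refl
overlapping⇒≡ (p ∷ s⋈) (here refl) (there q) ¬⋈    = contradiction (All.lookup p q) ¬⋈
overlapping⇒≡ {e = e} {e′} (p ∷ s⋈) (there q) (here refl) ¬⋈ =
  contradiction (⋈-sym {e = e′} {e} (All.lookup p q)) ¬⋈
overlapping⇒≡ (_ ∷ s⋈) (there p) (there q) ¬⋈      = overlapping⇒≡ s⋈ p q ¬⋈

conflicts : Neighbourhoods n → Arc n → List (Arc n)
conflicts G (x , y) =
  (map (x ,_) (neighbours G x) ++ map (_, x) (neighbours G x)) ++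
  (map (y ,_) (neighbours G y) ++ map (_, y) (neighbours G y))

length-conflicts : ∀ {Δ} (G : Neighbourhoods n) → IsRegularGraph Δ G →
                   ∀ e → length (conflicts G e) ≡ (Δ + Δ) + (Δ + Δ)
length-conflicts {Δ = Δ} G regular (x , y) =
  trans (length-++ (map (x ,_) (neighbours G x) ++ map (_, x) (neighbours G x)))
        (cong₂ _+_ (both x) (both y))
  where
  both : ∀ z → length (map (z ,_) (neighbours G z) ++ map (_, z) (neighbours G z)) ≡ Δ + Δ
  both z = trans (length-++ (map (z ,_) (neighbours G z)))
    (cong₂ _+_ (trans (length-map (z ,_) (neighbours G z)) (length-neighbours G regular z))
               (trans (length-map (_, z) (neighbours G z)) (length-neighbours G regular z)))

overlapping⇒∈-conflicts : (G : Neighbourhoods n) → IsSimpleGraph G →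
                          ∀ {e e′} → e′ ∈ arcs G → ¬ (e ⋈ e′) → e′ ∈ conflicts G e
overlapping⇒∈-conflicts G (_ , symmetric) {x , y} {x′ , y′} e′∈ ¬⋈
  with x Fin.≟ x′ | x Fin.≟ y′ | y Fin.≟ x′ | y Fin.≟ y′ | ∈-arcs⁻ G e′∈
... | yes refl | _ | _ | _ | y′∈ = ∈-++⁺ˡ (∈-++⁺ˡ (∈-map⁺ (x ,_) (∈-elements⁺ y′∈)))
... | no _ | yes refl | _ | _ | y′∈ =
  ∈-++⁺ˡ (∈-++⁺ʳ (map (x ,_) (neighbours G x)) (∈-map⁺ (_, x) (∈-elements⁺ (symmetric _ _ y′∈))))
... | no _ | no _ | yes refl | _ | y′∈ =
  ∈-++⁺ʳ (map (x ,_) (neighbours G x) ++ map (_, x) (neighbours G x))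
    (∈-++⁺ˡ (∈-map⁺ (y ,_) (∈-elements⁺ y′∈)))
... | no _ | no _ | no _ | yes refl | y′∈ =
  ∈-++⁺ʳ (map (x ,_) (neighbours G x) ++ map (_, x) (neighbours G x))
    (∈-++⁺ʳ (map (y ,_) (neighbours G y)) (∈-map⁺ (_, y) (∈-elements⁺ (symmetric _ _ y′∈))))
... | no p | no q | no r | no t | _ = contradiction ((p , q) , (r , t)) ¬⋈

selections : ℕ → Neighbourhoods n → List (List (Arc n))
selections r G = chains _⋈?_ r (arcs G)

-- Each selected arc rules out at most 4 Δ of the n Δ arcs.
length-selections-≥ : ∀ {Δ K} (G : Neighbourhoods n) → IsRegularGraph Δ G →
                      K + Δ * ((Δ + Δ) + (Δ + Δ)) ≤ n * Δ → K ^ Δ ≤ length (selections Δ G)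
length-selections-≥ {Δ = Δ} G regular@(simple , _) large =
  length-chains-≥ _⋈?_ (conflicts G) (λ e → ≤-reflexive (length-conflicts G regular e)) Δ
    (arcs-unique G) (λ _ → overlapping⇒∈-conflicts G simple)
    (≤-trans large (length-arcs-≥ G regular))

Deleted : List (Arc n) → Rel (Fin n) _
Deleted s x y = (x , y) ∈ s ⊎ (y , x) ∈ s

-- The new vertices are numbered 0 and 1 and the old ones shifted by two; 0 receives the first and 1
-- the second ends of the arcs.
Inserted : Neighbourhoods n → List (Arc n) → Rel (Fin (suc (suc n))) _
Inserted G s zero          (suc (suc y)) = y ∈ map proj₁ s
Inserted G s (suc zero)    (suc (suc y)) = y ∈ map proj₂ s
Inserted G s (suc (suc x)) zero          = x ∈ map proj₁ s
Inserted G s (suc (suc x)) (suc zero)    = x ∈ map proj₂ s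
Inserted G s (suc (suc x)) (suc (suc y)) = y ∈ˢ N G x × ¬ Deleted s x y
Inserted G s _             _             = ⊥

inserted? : (G : Neighbourhoods n) (s : List (Arc n)) → Binary.Decidable (Inserted G s)
inserted? {n} G s = λ where
    zero          zero          → no λ ()
    zero          (suc zero)    → no λ ()
    zero          (suc (suc y)) → y ∈ᶠ? map proj₁ s
    (suc zero)    zero          → no λ ()
    (suc zero)    (suc zero)    → no λ ()
    (suc zero)    (suc (suc y)) → y ∈ᶠ? map proj₂ s
    (suc (suc x)) zero          → x ∈ᶠ? map proj₁ s
    (suc (suc x)) (suc zero)    → x ∈ᶠ? map proj₂ s
    (suc (suc x)) (suc (suc y)) →
      (y ∈ˢ? N G x) ×-dec ¬? (((x , y) ∈ᵃ? s) ⊎-dec ((y , x) ∈ᵃ? s))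
  where
  open DecMembership (Fin._≟_ {n}) using () renaming (_∈?_ to _∈ᶠ?_)
  open DecMembership (≡-dec (Fin._≟_ {n}) (Fin._≟_ {n})) using () renaming (_∈?_ to _∈ᵃ?_)

insertion : Neighbourhoods n → List (Arc n) → Neighbourhoods (suc (suc n))
insertion G s = fromRelation (inserted? G s)

old : Fin n → Fin (suc (suc n))
old x = suc (suc x)

old-injective : {x y : Fin n} → old x ≡ old y → x ≡ y
old-injective refl = refl

insertion-simple : (G : Neighbourhoods n) (s : List (Arc n)) → IsSimpleGraph G → IsSimpleGraph (insertion G s)
insertion-simple G s (loopless , symmetric) =
  (λ x x∈ → irrefl x (∈-N⁻ (inserted? G s) x∈)) ,
  (λ x y y∈ → ∈-N⁺ (inserted? G s) (symm x y (∈-N⁻ (inserted? G s) y∈)))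
  where
  irrefl : ∀ x → ¬ Inserted G s x x
  irrefl (suc (suc x)) (x∈ , _) = loopless x x∈
  symm : ∀ x y → Inserted G s x y → Inserted G s y x
  symm zero          (suc (suc y)) p = p
  symm (suc zero)    (suc (suc y)) p = p
  symm (suc (suc x)) zero          p = p
  symm (suc (suc x)) (suc zero)    p = p
  symm (suc (suc x)) (suc (suc y)) (y∈ , ¬del) = symmetric x y y∈ , ¬del ∘ swap

module _ {Δ} (G : Neighbourhoods n) (regular : IsRegularGraph Δ G)
         {s : List (Arc n)} (s∈ : s ∈ selections Δ G) where

  private
    simple : IsSimpleGraph G
    simple = proj₁ regular

    s⊆arcs : ∀ {x y} → (x , y) ∈ s → y ∈ˢ N G x
    s⊆arcs e∈ = ∈-arcs⁻ G (All.lookup (proj₁ (∈-chains⁻ _⋈?_ Δ s∈)) e∈)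

    s⋈ : AllPairs _⋈_ s
    s⋈ = proj₁ (proj₂ (∈-chains⁻ _⋈?_ Δ s∈))

    ∣s∣≡Δ : length s ≡ Δ
    ∣s∣≡Δ = proj₂ (proj₂ (∈-chains⁻ _⋈?_ Δ s∈))

  deleted⇒adjacent : ∀ {x y} → Deleted s x y → y ∈ˢ N G x
  deleted⇒adjacent (inj₁ e∈) = s⊆arcs e∈
  deleted⇒adjacent (inj₂ e∈) = proj₂ simple _ _ (s⊆arcs e∈)

  -- Disjoint arcs meet a vertex at most once, so an old vertex loses at most one neighbour.
  deleted-functional : ∀ {x y y′} → Deleted s x y → Deleted s x y′ → y ≡ y′
  deleted-functional (inj₁ p) (inj₁ q) with refl ← overlapping⇒≡ s⋈ p q (λ ((f , _) , _) → f refl) = refl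
  deleted-functional (inj₂ p) (inj₂ q) with refl ← overlapping⇒≡ s⋈ p q (λ (_ , (_ , f)) → f refl) = refl
  -- With opposite orientations, equality of the arcs identifies x, y and y′.
  deleted-functional (inj₁ p) (inj₂ q) with refl ← overlapping⇒≡ s⋈ p q (λ ((_ , f) , _) → f refl) = refl
  deleted-functional (inj₂ p) (inj₁ q) with refl ← overlapping⇒≡ s⋈ p q (λ (_ , (f , _)) → f refl) = refl

  sources-unique : Unique (map proj₁ s)
  sources-unique = AllPairs.map⁺ (AllPairs.map (proj₁ ∘ proj₁) s⋈)

  targets-unique : Unique (map proj₂ s)
  targets-unique = AllPairs.map⁺ (AllPairs.map (proj₂ ∘ proj₂) s⋈)

  -- A vertex in both lists would make some selected arc a loop. Hence no old vertex is joined to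
  -- both new ones.
  sources∩targets : ∀ {x} → x ∈ map proj₁ s → x ∉ map proj₂ s
  sources∩targets p q
    with _ , p′ , refl ← ∈-map⁻ proj₁ p
    with _ , q′ , refl ← ∈-map⁻ proj₂ q
    with refl ← overlapping⇒≡ s⋈ p′ q′ (λ ((_ , f) , _) → f refl) = proj₁ simple _ (s⊆arcs p′)

  private
    new-degree : ∀ v {ys} → Unique ys → length ys ≡ length s →
                 (∀ {y} → y ∈ ys → Inserted G s v (old y)) →
                 (∀ {w} → Inserted G s v w → ∃[ y ] (w ≡ old y × y ∈ ys)) →
                 degree (insertion G s) v ≡ Δ
    new-degree v {ys} ys! ∣ys∣ sound complete = trans
      (degree-fromRelation (inserted? G s) (Unique.map⁺ old-injective ys!)
        (λ p → let (_ , y∈ , eq) = ∈-map⁻ old p in subst (Inserted G s _) (sym eq) (sound y∈))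
        (λ p → let (_ , eq , y∈) = complete p in subst (_∈ map old ys) (sym eq) (∈-map⁺ old y∈)))
      (trans (length-map old ys) (trans ∣ys∣ ∣s∣≡Δ))

    module _ {x y} (xy-deleted : Deleted s x y) (w : Fin (suc (suc n)))
             (w-new : ∀ {z} → w ≢ old z) (x~w : Inserted G s (old x) w)
             (w-only : ∀ {v} → Inserted G s (old x) v → v ≡ w ⊎ ∃[ z ] (v ≡ old z)) where

      kept : List (Fin n)
      kept = filter (_≢? y) (neighbours G x)

      kept! : Unique kept
      kept! = Unique.filter⁺ _ (elements-unique (N G x))

      length-kept : suc (length kept) ≡ Δ
      length-kept = trans
        (length-remove Fin._≟_ (elements-unique (N G x)) (∈-elements⁺ (deleted⇒adjacent xy-deleted)))
        (length-neighbours G regular x)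

      -- The end x of a selected arc trades its neighbour y for the new vertex `w`, and nothing else
      -- changes at x.
      touched-degree : degree (insertion G s) (old x) ≡ Δ
      touched-degree = trans
        (degree-fromRelation (inserted? G s)
          (All.map⁺ (All.universal (λ z → w-new) kept) ∷ Unique.map⁺ old-injective kept!) sound complete)
        (trans (cong suc (length-map old kept)) length-kept)
        where
        sound : ∀ {v} → v ∈ w ∷ map old kept → Inserted G s (old x) v
        sound (here refl) = x~w
        sound (there p) with z , z∈ , refl ← ∈-map⁻ old p
          with z∈N , z≢y ← ∈-filter⁻ (_≢? y) {xs = neighbours G x} z∈ =
          ∈-elements⁻ (N G x) z∈N , λ del → z≢y (deleted-functional del xy-deleted)
        complete : ∀ {v} → Inserted G s (old x) v → v ∈ w ∷ map old kept
        complete p with w-only p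
        ... | inj₁ refl = here refl
        ... | inj₂ (z , refl) = there (∈-map⁺ old (∈-filter⁺ (_≢? y)
                (∈-elements⁺ (proj₁ p)) (λ { refl → proj₂ p xy-deleted })))

    untouched-degree : ∀ {x} → x ∉ map proj₁ s → x ∉ map proj₂ s → degree (insertion G s) (old x) ≡ Δ
    untouched-degree {x} x∉₁ x∉₂ = trans
      (degree-fromRelation (inserted? G s) (Unique.map⁺ old-injective (elements-unique (N G x))) sound complete)
      (trans (length-map old (neighbours G x)) (length-neighbours G regular x))
      where
      sound : ∀ {v} → v ∈ map old (neighbours G x) → Inserted G s (old x) v
      sound p with z , z∈ , refl ← ∈-map⁻ old p = ∈-elements⁻ (N G x) z∈ , λ where
        (inj₁ e∈) → x∉₁ (∈-map⁺ proj₁ e∈)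
        (inj₂ e∈) → x∉₂ (∈-map⁺ proj₂ e∈)
      complete : ∀ {v} → Inserted G s (old x) v → v ∈ map old (neighbours G x)
      complete {zero}        p = contradiction p x∉₁
      complete {suc zero}    p = contradiction p x∉₂
      complete {suc (suc _)} p = ∈-map⁺ old (∈-elements⁺ (proj₁ p))

  insertion-degree : ∀ v → degree (insertion G s) v ≡ Δ
  insertion-degree zero = new-degree zero sources-unique (length-map proj₁ s) id
    λ { {zero} () ; {suc zero} () ; {suc (suc y)} p → y , refl , p }
  insertion-degree (suc zero) = new-degree (suc zero) targets-unique (length-map proj₂ s) id
    λ { {zero} () ; {suc zero} () ; {suc (suc y)} p → y , refl , p }
  insertion-degree (suc (suc x)) with DecMembership._∈?_ Fin._≟_ x (map proj₁ s)
  ... | yes x∈ with (_ , _) , e∈ , refl ← ∈-map⁻ proj₁ x∈ =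
    touched-degree (inj₁ e∈) zero (λ ()) x∈ λ
      { {zero} _ → inj₁ refl
      ; {suc zero} p → contradiction p (sources∩targets x∈)
      ; {suc (suc z)} _ → inj₂ (z , refl) }
  ... | no x∉ with DecMembership._∈?_ Fin._≟_ x (map proj₂ s)
  ...   | no x∉′ = untouched-degree x∉ x∉′
  ...   | yes x∈ with (_ , _) , e∈ , refl ← ∈-map⁻ proj₂ x∈ =
    touched-degree (inj₂ e∈) (suc zero) (λ ()) x∈ λ
      { {zero} p → contradiction p x∉
      ; {suc zero} _ → inj₁ refl
      ; {suc (suc z)} _ → inj₂ (z , refl) }

  insertion-regular : IsRegularGraph Δ (insertion G s)
  insertion-regular = insertion-simple G s simple , insertion-degree

  -- An edge of `G` either survives, and is then visible in the common insertion, or it was deleted,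
  -- and then it belongs to `s`, whose arcs are edges of `G′` as well.
  insertion-reflects-⊆ : ∀ G′ → (∀ {x y} → Deleted s x y → y ∈ˢ N G′ x) →
                         insertion G s ≡ insertion G′ s → ∀ {x y} → y ∈ˢ N G x → y ∈ˢ N G′ x
  insertion-reflects-⊆ G′ s⊆G′ eq {x} {y} y∈
    with inserted? G s (old x) (old y)
  ... | yes p = proj₁ (∈-N⁻ (inserted? G′ s) {old x} {old y}
          (subst (λ H → old y ∈ˢ N H (old x)) eq (∈-N⁺ (inserted? G s) {old x} {old y} p)))
  ... | no ¬p = s⊆G′ (decidable-stable (((x , y) ∈ᵃ? s) ⊎-dec ((y , x) ∈ᵃ? s)) (λ ¬del → ¬p (y∈ , ¬del)))
    where open DecMembership (≡-dec (Fin._≟_ {n}) (Fin._≟_ {n})) using () renaming (_∈?_ to _∈ᵃ?_)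

unzip-injective : {s t : List (A × B)} → map proj₁ s ≡ map proj₁ t → map proj₂ s ≡ map proj₂ t → s ≡ t
unzip-injective {s = []}    {[]}    _ _ = refl
unzip-injective {s = _ ∷ _} {_ ∷ _} p q with refl , p′ ← ∷-injective p with refl , q′ ← ∷-injective q =
  cong (_ ∷_) (unzip-injective p′ q′)

-- The number of regular graphs before and after an insertion

#regular : ℕ → ℕ → ℕ
#regular Δ n = length (regularGraphs Δ n)

-- Pairs of a graph and a selection are counted twice. `large` leaves `K` choices for each of the Δ
-- arcs; on the other side, reading the two ordered neighbourhoods position by position gives back
-- the arcs.
insertion-bound : ∀ Δ n K → K + Δ * ((Δ + Δ) + (Δ + Δ)) ≤ n * Δ →
                  #regular Δ n * K ^ Δ ≤ #regular Δ (suc (suc n)) * (Δ ! * Δ !)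
insertion-bound Δ n K large = begin
  #regular Δ n * K ^ Δ  ≤⟨ length-Σ-list-≥ (regularGraphs Δ n) (selections Δ)
                             (λ {G} G∈ → length-selections-≥ G (regular G∈) large) ⟩
  length before         ≤⟨ injection⇒length≤ Encodes encodes-injective before-unique encode ⟩
  length after          ≤⟨ length-Σ-list-≤ (regularGraphs Δ (suc (suc n))) orderings² length-orderings² ⟩
  #regular Δ (suc (suc n)) * (Δ ! * Δ !) ∎
  where
  open ≤-Reasoning
  regular : ∀ {n} {G : Neighbourhoods n} → G ∈ regularGraphs Δ n → IsRegularGraph Δ G
  regular {G = G} = Equivalence.to (∈-regularGraphs Δ G)

  before : List (Neighbourhoods n × List (Arc n))
  before = Σ-list (regularGraphs Δ n) (selections Δ)

  before-unique : Unique before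
  before-unique = Σ-list-unique (regularGraphs-unique Δ n) (λ G → chains-unique _⋈?_ Δ (arcs-unique G))

  orderings : Neighbourhoods (suc (suc n)) → Fin (suc (suc n)) → List (List (Fin (suc (suc n))))
  orderings H v = chains _≢?_ Δ (neighbours H v)

  orderings² : Neighbourhoods (suc (suc n)) → List (List (Fin (suc (suc n))) × List (Fin (suc (suc n))))
  orderings² H = cartesianProduct (orderings H zero) (orderings H (suc zero))

  after : List (Neighbourhoods (suc (suc n)) × List (Fin (suc (suc n))) × List (Fin (suc (suc n))))
  after = Σ-list (regularGraphs Δ (suc (suc n))) orderings²

  length-orderings² : ∀ {H} → H ∈ regularGraphs Δ (suc (suc n)) → length (orderings² H) ≤ Δ ! * Δ !
  length-orderings² {H} H∈ = ≤-trans
    (≤-reflexive (length-cartesianProductWith _,_ (orderings H zero) (orderings H (suc zero))))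
    (*-mono-≤ (bound zero) (bound (suc zero)))
    where
    bound : ∀ v → length (orderings H v) ≤ Δ !
    bound v = length-chains-≤ _≢?_ (λ x≢x → x≢x refl) Δ (neighbours H v)
      (≤-reflexive (length-neighbours H (regular H∈) v))

  -- Regularity and membership among the selections are kept because only they show that the deleted
  -- arcs are edges of both graphs compared in `encodes-injective`.
  Encodes : Neighbourhoods n × List (Arc n) →
            Neighbourhoods (suc (suc n)) × List (Fin (suc (suc n))) × List (Fin (suc (suc n))) → Set
  Encodes (G , s) (H , us , ws) =
    (IsRegularGraph Δ G × s ∈ selections Δ G) ×
    H ≡ insertion G s × us ≡ map old (map proj₁ s) × ws ≡ map old (map proj₂ s)

  encodes-injective : ∀ {x x′ y} → Encodes x y → Encodes x′ y → x ≡ x′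
  encodes-injective {G , s} {G′ , s′} ((reg , s∈) , refl , refl , refl) ((reg′ , s′∈) , eq , us≡ , ws≡)
    with refl ← unzip-injective {s = s} {s′} (map-injective old-injective us≡) (map-injective old-injective ws≡) =
    cong (_, s) (graph-ext
      (insertion-reflects-⊆ G reg s∈ G′ (deleted⇒adjacent G′ reg′ s′∈) eq)
      (insertion-reflects-⊆ G′ reg′ s′∈ G (deleted⇒adjacent G reg s∈) (sym eq)))

  encode : ∀ {x} → x ∈ before → ∃[ y ] (y ∈ after × Encodes x y)
  encode {G , s} p with G∈ , s∈ ← ∈-Σ-list⁻ (regularGraphs Δ n) p =
    (H , us , ws) , ∈-Σ-list⁺ H∈ (∈-cartesianProduct⁺ us∈ ws∈) , (regular G∈ , s∈) , refl , refl , refl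
    where
    H : Neighbourhoods (suc (suc n))
    H = insertion G s
    us ws : List (Fin (suc (suc n)))
    us = map old (map proj₁ s)
    ws = map old (map proj₂ s)
    H∈ : H ∈ regularGraphs Δ (suc (suc n))
    H∈ = Equivalence.from (∈-regularGraphs Δ H) (insertion-regular G (regular G∈) s∈)
    ∣s∣ : length s ≡ Δ
    ∣s∣ = proj₂ (proj₂ (∈-chains⁻ _⋈?_ Δ s∈))
    ordering : ∀ v {vs} → Unique vs → length vs ≡ length s → (∀ {y} → y ∈ vs → Inserted G s v (old y)) →
               map old vs ∈ orderings H v
    ordering v {vs} vs! ∣vs∣ vs⊆ =
      subst (λ r → map old vs ∈ chains _≢?_ r (neighbours H v)) (trans (length-map old vs) (trans ∣vs∣ ∣s∣))
        (∈-chains⁺ _≢?_ (All.map⁺ (All.tabulate (λ y∈ → ∈-elements⁺ (∈-N⁺ (inserted? G s) (vs⊆ y∈)))))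
          (Unique.map⁺ old-injective vs!))
    us∈ : us ∈ orderings H zero
    us∈ = ordering zero (sources-unique G (regular G∈) s∈) (length-map proj₁ s) id
    ws∈ : ws ∈ orderings H (suc zero)
    ws∈ = ordering (suc zero) (targets-unique G (regular G∈) s∈) (length-map proj₂ s) id

-- Graphs with a frozen colouring

map-≡⇒≗ : {f g : A → B} (xs : List A) → map f xs ≡ map g xs → ∀ {x} → x ∈ xs → f x ≡ g x
map-≡⇒≗ (x ∷ xs) eq (here refl) = proj₁ (∷-injective eq)
map-≡⇒≗ (x ∷ xs) eq (there x∈)  = map-≡⇒≗ xs (proj₂ (∷-injective eq)) x∈

-- Only the pairs i < j are listed, so that each matching between two colour classes is coded once.
pairs : ∀ k → List (Fin k × Fin k)
pairs zero    = []
pairs (suc k) = map (λ j → zero , suc j) (allFin k) ++ map (Product.map suc suc) (pairs k)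

∈-pairs⁺ : ∀ {k} {i j : Fin k} → i <ᶠ j → (i , j) ∈ pairs k
∈-pairs⁺ {i = zero}  {suc j} _ = ∈-++⁺ˡ (∈-map⁺ (λ j → zero , suc j) (∈-allFin j))
∈-pairs⁺ {i = suc i} {suc j} (s≤s i<j) = ∈-++⁺ʳ _ (∈-map⁺ (Product.map suc suc) (∈-pairs⁺ i<j))

∈-pairs⁻ : ∀ k {i j : Fin k} → (i , j) ∈ pairs k → i ≢ j
∈-pairs⁻ (suc k) p refl with ∈-++⁻ (map (λ j → zero , suc j) (allFin k)) p
... | inj₁ q with _ , _ , () ← ∈-map⁻ (λ j → zero , suc j) q
... | inj₂ q with _ , r , refl ← ∈-map⁻ (Product.map suc suc) q = ∈-pairs⁻ k r refl

#pairs : ℕ → ℕ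
#pairs k = length (pairs k)

#pairs-suc : ∀ k → #pairs (suc k) ≡ k + #pairs k
#pairs-suc k = trans (length-++ (map (λ j → zero , suc j) (allFin k)))
  (cong₂ _+_ (trans (length-map (λ j → zero , suc j) (allFin k)) (length-tabulate {n = k} id))
             (length-map (Product.map suc suc) (pairs k)))

-- The formula for a binomial coefficient, doubled to avoid division; `f-step` needs exactly the
-- double, since going from m! to (m + 2)! brings in two factors.
double-#pairs : ∀ k → #pairs (suc k) + #pairs (suc k) ≡ suc k * k
double-#pairs zero    = refl
double-#pairs (suc k) = begin
  #pairs (suc (suc k)) + #pairs (suc (suc k)) ≡⟨ cong (λ t → t + t) (#pairs-suc (suc k)) ⟩
  (suc k + p) + (suc k + p)   ≡⟨ solve 2 (λ k p → (k :+ p) :+ (k :+ p) := (k :+ k) :+ (p :+ p)) refl (suc k) p ⟩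
  (suc k + suc k) + (p + p)   ≡⟨ cong ((suc k + suc k) +_) (double-#pairs k) ⟩
  (suc k + suc k) + suc k * k ≡⟨ solve 1 (λ k → ((con 1 :+ k) :+ (con 1 :+ k)) :+ (con 1 :+ k) :* k := (con 2 :+ k) :* (con 1 :+ k)) refl k ⟩
  suc (suc k) * suc k         ∎
  where
  open ≡-Reasoning
  p : ℕ
  p = #pairs (suc k)

class : ∀ {k} → (Fin n → Fin k) → Fin k → List (Fin n)
class α c = filter (λ v → α v Fin.≟ c) (allFin _)

module _ {k} (α : Fin n → Fin k) where

  ∈-class⁺ : ∀ {v c} → α v ≡ c → v ∈ class α c
  ∈-class⁺ {v} = ∈-filter⁺ (λ v → α v Fin.≟ _) (∈-allFin v)

  ∈-class⁻ : ∀ {v c} → v ∈ class α c → α v ≡ c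
  ∈-class⁻ v∈ = proj₂ (∈-filter⁻ (λ v → α v Fin.≟ _) {xs = allFin n} v∈)

  class-unique : ∀ c → Unique (class α c)
  class-unique c = Unique.filter⁺ (λ v → α v Fin.≟ c) (Unique.allFin⁺ n)

  size-of-classes : ∀ {m} → (∀ c → length (class α c) ≡ m) → n ≡ k * m
  size-of-classes {m} balanced = trans (trans (sym (length-tabulate {n = n} id)) n≡∣Σ∣) ∣Σ∣≡km
    where
    Σ-classes : List (Fin k × Fin n)
    Σ-classes = Σ-list (allFin k) (class α)
    n≡∣Σ∣ : length (allFin n) ≡ length Σ-classes
    n≡∣Σ∣ = ≤-antisym
      (injection⇒length≤ {ys = Σ-classes} (λ v (c , v′) → v ≡ v′) (λ { refl refl → refl }) (Unique.allFin⁺ n)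
        (λ {v} _ → (α v , v) , ∈-Σ-list⁺ {f = class α} (∈-allFin (α v)) (∈-class⁺ refl) , refl))
      (injection⇒length≤ (λ (c , v) v′ → v ≡ v′ × α v ≡ c) (λ { (refl , refl) (refl , refl) → refl })
        (Σ-list-unique (Unique.allFin⁺ k) class-unique)
        (λ {(c , v)} p → v , ∈-allFin v , refl , ∈-class⁻ (proj₂ (∈-Σ-list⁻ (allFin k) p))))
    ∣Σ∣≡km : length Σ-classes ≡ k * m
    ∣Σ∣≡km = subst (λ k′ → length Σ-classes ≡ k′ * m) (length-tabulate {n = k} id) (≤-antisym
      (length-Σ-list-≤ (allFin k) (class α) (λ {c} _ → ≤-reflexive (balanced c)))
      (length-Σ-list-≥ (allFin k) (class α) (λ {c} _ → ≤-reflexive (sym (balanced c)))))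

module Frozen {Δ} (G : Neighbourhoods n) (regular : IsRegularGraph Δ G)
              {α : Fin n → Fin (suc Δ)} (frozen : IsFrozen G α) where

  private
    symmetric : ∀ x y → y ∈ˢ N G x → x ∈ˢ N G y
    symmetric = proj₂ (proj₁ regular)

    proper : IsProper G α
    proper = proj₁ frozen

  -- For the colour of v this is v itself; for any other colour it is the mate of v in the matching
  -- between the two classes.
  partner : Fin n → Fin (suc Δ) → Fin n
  partner v c = proj₁ (proj₂ frozen v c)

  α-partner : ∀ v c → α (partner v c) ≡ c
  α-partner v c = proj₂ (proj₂ (proj₂ frozen v c))

  closed : Fin n → List (Fin n)
  closed v = v ∷ neighbours G v

  partner∈closed : ∀ v c → partner v c ∈ closed v
  partner∈closed v c with x∈p∪q⁻ (N G v) _ (proj₁ (proj₂ (proj₂ frozen v c)))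
  ... | inj₁ u∈N = there (∈-elements⁺ u∈N)
  ... | inj₂ u∈v = here (x∈⁅y⁆⇒x≡y v u∈v)

  partner∈N : ∀ {v c} → α v ≢ c → partner v c ∈ˢ N G v
  partner∈N {v} {c} αv≢c with partner∈closed v c
  ... | here u≡v = contradiction (trans (cong α (sym u≡v)) (α-partner v c)) αv≢c
  ... | there u∈ = ∈-elements⁻ (N G v) u∈

  -- A closed neighbourhood has Δ + 1 members and shows all Δ + 1 colours, so no colour is repeated
  -- in it.
  rainbow : ∀ {v u u′} → u ∈ closed v → u′ ∈ closed v → α u ≡ α u′ → u ≡ u′
  rainbow {v} u∈ u′∈ eq = covering⇒injective α (Unique.allFin⁺ (suc Δ))
    (λ {c} _ → partner v c , partner∈closed v c , α-partner v c)
    (≤-reflexive (trans (cong suc (length-neighbours G regular v)) (sym (length-tabulate {n = suc Δ} id))))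
    u∈ u′∈ eq Fin._≟_

  partner-unique : ∀ {x y} → y ∈ˢ N G x → partner x (α y) ≡ y
  partner-unique {x} {y} y∈ = rainbow (partner∈closed x (α y)) (there (∈-elements⁺ y∈)) (α-partner x (α y))

  -- Seen from the common partner, v and v′ are two neighbours of the same colour, which `rainbow`
  -- identifies.
  partner-injective : ∀ {v v′ c} → α v ≢ c → α v ≡ α v′ → partner v c ≡ partner v′ c → v ≡ v′
  partner-injective {v} {v′} {c} αv≢c αv≡αv′ eq = rainbow {v = partner v c}
    (there (∈-elements⁺ (symmetric _ _ (partner∈N αv≢c))))
    (there (∈-elements⁺ (symmetric _ _ (subst (_∈ˢ N G v′) (sym eq) (partner∈N (αv≢c ∘ trans αv≡αv′))))))
    αv≡αv′

  -- Taking partners injects one class into the other; exchanging the roles makes all classes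
  -- equally large.
  class-≤ : ∀ i j → length (class α i) ≤ length (class α j)
  class-≤ i j with i Fin.≟ j
  ... | yes refl = ≤-refl
  ... | no i≢j = injection⇒length≤ (λ v w → α v ≡ i × partner v j ≡ w)
    (λ (p , q) (p′ , q′) → partner-injective (i≢j ∘ trans (sym p)) (trans p (sym p′)) (trans q (sym q′)))
    (class-unique α i)
    (λ {v} v∈ → partner v j , ∈-class⁺ α (α-partner v j) , ∈-class⁻ α v∈ , refl)

  class-size : ∃[ m ] (∀ c → length (class α c) ≡ m)
  class-size = length (class α zero) , λ c → ≤-antisym (class-≤ c zero) (class-≤ zero c)

  n≡k*m : ∃[ m ] n ≡ suc Δ * m
  n≡k*m = proj₁ class-size , size-of-classes α (proj₂ class-size)

  -- For every i < j, the mates in class j of the vertices of class i, in the order in which `class`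
  -- lists them. Together with the colouring this fixes all edges.
  code : List (List (Fin n))
  code = map (λ (i , j) → map (λ v → partner v j) (class α i)) (pairs (suc Δ))

matchings : ∀ {k} → ℕ → (Fin n → Fin k) → Fin k × Fin k → List (List (Fin n))
matchings m α (i , j) = chains _≢?_ m (class α j)

module _ {Δ} (G : Neighbourhoods n) (regular : IsRegularGraph Δ G)
         {α : Fin n → Fin (suc Δ)} (frozen : IsFrozen G α) where

  open Frozen G regular frozen

  code∈choices : ∀ {m} → (∀ c → length (class α c) ≡ m) →
                 code ∈ choices (map (matchings m α) (pairs (suc Δ)))
  code∈choices {m} balanced = ∈-choices⁺ _ (matchings m α) λ {(i , j)} p →
    let i≢j = ∈-pairs⁻ (suc Δ) p in
    subst (λ r → map (λ v → partner v j) (class α i) ∈ chains _≢?_ r (class α j))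
      (trans (length-map (λ v → partner v j) (class α i)) (balanced i))
      (∈-chains⁺ _≢?_
        (All.map⁺ (All.tabulate (λ {v} _ → ∈-class⁺ α (α-partner v j))))
        (AllPairs.map⁺ (distinct i≢j (class-unique α i) (All.tabulate (∈-class⁻ α)))))
    where
    distinct : ∀ {i j vs} → i ≢ j → Unique vs → All (λ v → α v ≡ i) vs →
               AllPairs (λ v v′ → partner v j ≢ partner v′ j) vs
    distinct i≢j [] [] = []
    distinct i≢j (v∉ ∷ vs!) (αv≡i ∷ αvs≡i) =
      All.zipWith (λ (v≢v′ , αv′≡i) eq → v≢v′ (partner-injective
        (i≢j ∘ trans (sym αv≡i)) (trans αv≡i (sym αv′≡i)) eq)) (v∉ , αvs≡i)
      ∷ distinct i≢j vs! αvs≡i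

  module _ (H : Neighbourhoods n) (regularᴴ : IsRegularGraph Δ H) (frozenᴴ : IsFrozen H α) where

    private module ᴴ = Frozen H regularᴴ frozenᴴ

    private
      upwards : code ≡ ᴴ.code → ∀ {x y} → α x <ᶠ α y → y ∈ˢ N G x → y ∈ˢ N H x
      upwards eq {x} {y} αx<αy y∈ = subst (_∈ˢ N H x)
        (trans (sym (map-≡⇒≗ (class α (α x)) (map-≡⇒≗ (pairs (suc Δ)) eq (∈-pairs⁺ αx<αy)) (∈-class⁺ α refl)))
               (partner-unique y∈))
        (ᴴ.partner∈N (Fin.<⇒≢ αx<αy))

    -- Both graphs share α, so their codes can be compared entry by entry. An edge is read off at
    -- its end of smaller colour; the other orientation follows by symmetry.
    code-reflects-⊆ : code ≡ ᴴ.code → ∀ {x y} → y ∈ˢ N G x → y ∈ˢ N H x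
    code-reflects-⊆ eq {x} {y} y∈ with Fin.<-cmp (α x) (α y)
    ... | tri< αx<αy _ _ = upwards eq αx<αy y∈
    ... | tri≈ _ αx≡αy _ = contradiction αx≡αy (proj₁ frozen x y y∈)
    ... | tri> _ _ αy<αx =
      proj₂ (proj₁ regularᴴ) y x (upwards eq αy<αx (proj₂ (proj₁ regular) x y y∈))

-- Upper bound for the number of graphs with a frozen colouring

length-vectorsOver : (xs : List A) → ∀ n → length (vectorsOver xs n) ≡ length xs ^ n
length-vectorsOver xs zero    = refl
length-vectorsOver xs (suc n) = trans (length-cartesianProductWith Vec._∷_ xs (vectorsOver xs n))
  (cong (length xs *_) (length-vectorsOver xs n))

frozenGraphs : ∀ Δ n → List (Neighbourhoods n)
frozenGraphs Δ n = filter (hasFrozenColouring? (suc Δ)) (regularGraphs Δ n)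

∈-frozenGraphs⁻ : ∀ {Δ n} {G : Neighbourhoods n} → G ∈ frozenGraphs Δ n →
                  IsRegularGraph Δ G × HasFrozenColouring (suc Δ) G
∈-frozenGraphs⁻ {Δ} {n} {G} G∈
  with p , q ← ∈-filter⁻ (hasFrozenColouring? (suc Δ)) {xs = regularGraphs Δ n} G∈ =
  Equivalence.to (∈-regularGraphs Δ G) p , q

frozenGraphs-bound : ∀ Δ m → let k = suc Δ in
                     length (frozenGraphs Δ (k * m)) ≤ k ^ (k * m) * (m !) ^ #pairs k
frozenGraphs-bound Δ m = begin
  length (frozenGraphs Δ km) ≤⟨ injection⇒length≤ Encodes (λ {G} {H} {c} → encodes-injective {G} {H} {c}) unique encode ⟩
  length codes              ≤⟨ length-Σ-list-≤ colourings matchings* length-matchings* ⟩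
  length colourings * (m !) ^ #pairs k
    ≤⟨ *-monoˡ-≤ ((m !) ^ #pairs k) (length-filter balanced? (vectorsOver (allFin k) km)) ⟩
  length (vectorsOver (allFin k) km) * (m !) ^ #pairs k
    ≡⟨ cong (_* (m !) ^ #pairs k) (trans (length-vectorsOver (allFin k) km) (cong (_^ km) (length-tabulate {n = k} id))) ⟩
  k ^ km * (m !) ^ #pairs k ∎
  where
  open ≤-Reasoning
  k km : ℕ
  k = suc Δ
  km = k * m

  Balanced : Vec.Vec (Fin k) km → Set
  Balanced α = ∀ c → length (class (Vec.lookup α) c) ≡ m

  balanced? : Decidable Balanced
  balanced? α = Fin.all? (λ c → length (class (Vec.lookup α) c) ≟ᴺ m)

  -- Balance gives each class exactly m vertices, so that m ! bounds the matchings into it.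
  colourings : List (Vec.Vec (Fin k) km)
  colourings = filter balanced? (vectorsOver (allFin k) km)

  matchings* : Vec.Vec (Fin k) km → List (List (List (Fin km)))
  matchings* α = choices (map (matchings m (Vec.lookup α)) (pairs k))

  codes : List (Vec.Vec (Fin k) km × List (List (Fin km)))
  codes = Σ-list colourings matchings*

  length-matchings* : ∀ {α} → α ∈ colourings → length (matchings* α) ≤ (m !) ^ #pairs k
  length-matchings* {α} α∈ = length-choices-≤ (matchings m (Vec.lookup α)) (pairs k) λ (i , j) →
    length-chains-≤ _≢?_ (λ x≢x → x≢x refl) m (class (Vec.lookup α) j)
      (≤-reflexive (proj₂ (∈-filter⁻ balanced? {xs = vectorsOver (allFin k) km} α∈) j))

  unique : Unique (frozenGraphs Δ km)
  unique = Unique.filter⁺ (hasFrozenColouring? k) (regularGraphs-unique Δ km)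

  -- The code is read from the witnesses inside a proof of frozenness, so that proof is part of the
  -- relation.
  Encodes : Neighbourhoods km → Vec.Vec (Fin k) km × List (List (Fin km)) → Set
  Encodes G (α , c) = Σ (IsRegularGraph Δ G) λ regular → Σ (IsFrozen G (Vec.lookup α)) λ frozen →
    c ≡ Frozen.code G regular frozen

  encodes-injective : ∀ {G H c} → Encodes G c → Encodes H c → G ≡ H
  encodes-injective {G} {H} (regᴳ , frᴳ , refl) (regᴴ , frᴴ , eq) = graph-ext
    (code-reflects-⊆ G regᴳ frᴳ H regᴴ frᴴ eq)
    (code-reflects-⊆ H regᴴ frᴴ G regᴳ frᴳ (sym eq))

  encode : ∀ {G} → G ∈ frozenGraphs Δ km → ∃[ c ] (c ∈ codes × Encodes G c)
  encode {G} G∈ with regular , β , frozenᵝ ← ∈-frozenGraphs⁻ G∈ =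
    (α , Frozen.code G regular frozen) ,
    ∈-Σ-list⁺ (∈-filter⁺ balanced? (∈-vectorsOver ∈-allFin α) balanced)
              (code∈choices G regular frozen balanced) ,
    regular , frozen , refl
    where
    α : Vec.Vec (Fin k) km
    α = Vec.tabulate β
    frozen : IsFrozen G (Vec.lookup α)
    frozen = isFrozen-resp-≗ G (λ v → sym (Vec.lookup∘tabulate β v)) frozenᵝ
    balanced : Balanced α
    balanced with m′ , sizes ← Frozen.class-size G regular frozen = λ c →
      trans (sizes c) (sym (*-cancelˡ-≡ m m′ k (size-of-classes (Vec.lookup α) sizes)))

∈-frozenGraphs⇒divisible : ∀ {Δ n} {G : Neighbourhoods n} → G ∈ frozenGraphs Δ n → ∃[ m ] n ≡ suc Δ * m
∈-frozenGraphs⇒divisible {G = G} G∈ with regular , α , frozen ← ∈-frozenGraphs⁻ G∈ =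
  Frozen.n≡k*m G regular frozen

-- Disjoint unions of complete graphs

module _ (Δ m : ℕ) where

  private
    k : ℕ
    k = suc Δ

  SameBlock : Rel (Fin (m * k)) _
  SameBlock x y = quotient {m} k x ≡ quotient {m} k y × x ≢ y

  sameBlock? : Binary.Decidable SameBlock
  sameBlock? x y = (quotient {m} k x Fin.≟ quotient {m} k y) ×-dec (x ≢? y)

  cliques : Neighbourhoods (m * k)
  cliques = fromRelation sameBlock?

  cliques-regular : IsRegularGraph Δ cliques
  cliques-regular =
    ((λ x x∈ → proj₂ (∈-N⁻ sameBlock? {x} x∈) refl) ,
     (λ x y y∈ → let (q , x≢y) = ∈-N⁻ sameBlock? {x} y∈ in ∈-N⁺ sameBlock? {y} (sym q , x≢y ∘ sym))) ,
    degree-cliques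
    where
    degree-cliques : ∀ x → degree cliques x ≡ Δ
    degree-cliques x = trans
      (degree-fromRelation sameBlock? {x} (Unique.map⁺ (proj₂ ∘ Fin.combine-injective q _ q _) others!) sound complete)
      (trans (length-map (combine q) others)
        (suc-injective (trans (length-remove Fin._≟_ (Unique.allFin⁺ k) (∈-allFin r)) (length-tabulate {n = k} id))))
      where
      q : Fin m
      q = quotient {m} k x
      r : Fin k
      r = remainder {m} k x
      x≡ : combine q r ≡ x
      x≡ = Fin.combine-remQuot {m} k x
      others : List (Fin k)
      others = filter (_≢? r) (allFin k)
      others! : Unique others
      others! = Unique.filter⁺ (_≢? r) (Unique.allFin⁺ k)
      sound : ∀ {y} → y ∈ map (combine q) others → SameBlock x y
      sound p with s , s∈ , refl ← ∈-map⁻ (combine q) p =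
        sym (cong proj₁ (Fin.remQuot-combine q s)) ,
        λ x≡y → proj₂ (∈-filter⁻ (_≢? r) {xs = allFin k} s∈)
          (sym (proj₂ (Fin.combine-injective q r q s (trans x≡ x≡y))))
      complete : ∀ {y} → SameBlock x y → y ∈ map (combine q) others
      complete {y} (q≡ , x≢y) = subst (_∈ map (combine q) others) y≡
        (∈-map⁺ (combine q) (∈-filter⁺ (_≢? r) (∈-allFin _)
          (λ s≡r → x≢y (trans (sym x≡) (trans (cong (combine q) (sym s≡r)) y≡)))))
        where
        y≡ : combine q (remainder {m} k y) ≡ y
        y≡ = trans (cong (λ q′ → combine q′ (remainder {m} k y)) q≡) (Fin.combine-remQuot {m} k y)

-- Starts the induction: a bound by a multiple of the number of regular graphs can hold at the base
-- only if this number is positive.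
#regular>0 : ∀ Δ m → 0 < #regular Δ (m * suc Δ)
#regular>0 Δ m = ∈-length (Equivalence.from (∈-regularGraphs Δ (cliques Δ m)) (cliques-regular Δ m))

-- Comparison of the growth rates

^-distribʳ-* : ∀ r x y → (x * y) ^ r ≡ x ^ r * y ^ r
^-distribʳ-* zero    x y = refl
^-distribʳ-* (suc r) x y = trans (cong (x * y *_) (^-distribʳ-* r x y))
  (solve 4 (λ x y p q → x :* y :* (p :* q) := x :* p :* (y :* q)) refl x y (x ^ r) (y ^ r))

-- This is (y / z)^r ≥ 1 - r c / z, cleared of denominators and of subtraction.
bernoulli : ∀ y c r → let z = y + c in z ^ r * z ≤ y ^ r * z + r * c * z ^ r
bernoulli y c zero    = m≤m+n _ _
bernoulli y c (suc r) = begin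
  z * z ^ r * z
    ≡⟨ solve 2 (λ z p → z :* p :* z := p :* z :* z) refl z (z ^ r) ⟩
  z ^ r * z * z
    ≤⟨ *-monoˡ-≤ z (bernoulli y c r) ⟩
  (y ^ r * z + r * c * z ^ r) * z
    ≡⟨ solve 5 (λ y c q r p → (q :* (y :+ c) :+ r :* c :* p) :* (y :+ c) :=
                 y :* q :* (y :+ c) :+ (q :* (c :* (y :+ c)) :+ r :* c :* ((y :+ c) :* p))) refl y c (y ^ r) r (z ^ r) ⟩
  y * y ^ r * z + (y ^ r * (c * z) + r * c * (z * z ^ r))
    ≤⟨ +-monoʳ-≤ (y * y ^ r * z) (+-monoˡ-≤ (r * c * (z * z ^ r)) (*-monoˡ-≤ (c * z) (^-monoˡ-≤ r (m≤m+n y c)))) ⟩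
  y * y ^ r * z + (z ^ r * (c * z) + r * c * (z * z ^ r))
    ≡⟨ solve 5 (λ z c r p q → q :* z :+ (p :* (c :* z) :+ r :* c :* (z :* p)) :=
                 q :* z :+ (c :+ r :* c) :* (z :* p)) refl z c r (z ^ r) (y * y ^ r) ⟩
  y * y ^ r * z + suc r * c * (z * z ^ r) ∎
  where
  open ≤-Reasoning
  z : ℕ
  z = y + c

-- When r c is at most a third of z, Bernoulli leaves (y / z)^r ≥ 2/3. Here the factor 3/2 is spent.
small-loss : ∀ y c r → 0 < y + c → 3 * (r * c) ≤ y + c → 2 * (y + c) ^ r ≤ 3 * y ^ r
small-loss y c r z>0 3rc≤z = *-cancelʳ-≤ _ _ z {{ℕ.>-nonZero z>0}} (+-cancelʳ-≤ (z * z ^ r) _ _ (begin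
  2 * z ^ r * z + z * z ^ r               ≡⟨ solve 2 (λ z p → con 2 :* p :* z :+ z :* p := con 3 :* (p :* z)) refl z (z ^ r) ⟩
  3 * (z ^ r * z)                         ≤⟨ *-monoʳ-≤ 3 (bernoulli y c r) ⟩
  3 * (y ^ r * z + r * c * z ^ r)         ≡⟨ solve 4 (λ z q d p → con 3 :* (q :* z :+ d :* p) := con 3 :* q :* z :+ con 3 :* d :* p) refl z (y ^ r) (r * c) (z ^ r) ⟩
  3 * y ^ r * z + 3 * (r * c) * z ^ r     ≤⟨ +-monoʳ-≤ (3 * y ^ r * z) (*-monoˡ-≤ (z ^ r) 3rc≤z) ⟩
  3 * y ^ r * z + z * z ^ r               ∎))
  where
  open ≤-Reasoning
  z : ℕ
  z = y + c

-- Induction on Δ. In Δ^Δ one factor is raised to k and the other Δ - 1 to k + 1; with the (k + 1)²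
-- from the two factorials they complete (k (k + 1))^k.
entropy-gap : ∀ Δ → 3 ≤ Δ → 3 * (suc Δ ! * suc Δ !) ≤ (suc Δ * Δ) ^ Δ
entropy-gap (suc zero)          (s≤s ())
entropy-gap (suc (suc zero))    (s≤s (s≤s ()))
entropy-gap (suc (suc (suc d))) _ = gap d
  where
  open ≤-Reasoning
  gap : ∀ d → 3 * ((4 + d) ! * (4 + d) !) ≤ ((4 + d) * (3 + d)) ^ (3 + d)
  -- Both sides are 1728.
  gap zero    = ≤-refl
  gap (suc d) = begin
    3 * (k′ * k ! * (k′ * k !))  ≡⟨ solve 2 (λ k′ f → con 3 :* (k′ :* f :* (k′ :* f)) := con 3 :* (f :* f) :* (k′ :* k′)) refl k′ (k !) ⟩
    3 * (k ! * k !) * (k′ * k′)  ≤⟨ *-monoˡ-≤ (k′ * k′) (gap d) ⟩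
    (k * Δ) ^ Δ * (k′ * k′)      ≡⟨ cong (_* (k′ * k′)) (^-distribʳ-* Δ k Δ) ⟩
    k ^ Δ * (Δ * Δ ^ e) * (k′ * k′)
      ≤⟨ *-monoˡ-≤ (k′ * k′) (*-monoʳ-≤ (k ^ Δ) (*-mono-≤ (n≤1+n Δ) (^-monoˡ-≤ e (≤-trans (n≤1+n Δ) (n≤1+n k))))) ⟩
    k ^ Δ * (k * k′ ^ e) * (k′ * k′)
      ≡⟨ solve 4 (λ k k′ p q → p :* (k :* q) :* (k′ :* k′) := (k′ :* k) :* ((k′ :* q) :* p)) refl k k′ (k ^ Δ) (k′ ^ e) ⟩
    (k′ * k) * (k′ ^ Δ * k ^ Δ)  ≡⟨ cong ((k′ * k) *_) (^-distribʳ-* Δ k′ k) ⟨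
    (k′ * k) ^ k                 ∎
    where
    e Δ k k′ : ℕ
    e = 2 + d
    Δ = 3 + d
    k = 4 + d
    k′ = 5 + d

-- The arcs ruled out during one insertion: at most 4 Δ for each of the Δ selected arcs.
loss : ℕ → ℕ
loss Δ = Δ * ((Δ + Δ) + (Δ + Δ))

-- One `K` serves all `j` insertions because the number of arcs only grows. In the form `j * 2 + n`,
-- two more vertices are two more `suc` by computation.
insertions-bound : ∀ Δ n K j → K + loss Δ ≤ n * Δ →
                   #regular Δ n * (K ^ Δ) ^ j ≤ #regular Δ (j * 2 + n) * (Δ ! * Δ !) ^ j
insertions-bound Δ n K zero    large = ≤-refl
insertions-bound Δ n K (suc j) large = begin
  #regular Δ n * (P * P ^ j)               ≡⟨ solve 3 (λ g p q → g :* (p :* q) := g :* q :* p) refl (#regular Δ n) P (P ^ j) ⟩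
  #regular Δ n * P ^ j * P                 ≤⟨ *-monoˡ-≤ P (insertions-bound Δ n K j large) ⟩
  #regular Δ (j * 2 + n) * D ^ j * P       ≡⟨ solve 3 (λ g p q → g :* q :* p := g :* p :* q) refl (#regular Δ (j * 2 + n)) P (D ^ j) ⟩
  #regular Δ (j * 2 + n) * P * D ^ j       ≤⟨ *-monoˡ-≤ (D ^ j) (insertion-bound Δ (j * 2 + n) K
                                                (≤-trans large (*-monoˡ-≤ Δ (m≤n+m n (j * 2))))) ⟩
  #regular Δ (suc j * 2 + n) * D * D ^ j   ≡⟨ *-assoc (#regular Δ (suc j * 2 + n)) D (D ^ j) ⟩
  #regular Δ (suc j * 2 + n) * (D * D ^ j) ∎
  where
  open ≤-Reasoning
  P D : ℕ
  P = K ^ Δ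
  D = Δ ! * Δ !

two-step-induction : (P : ℕ → Set) → ∀ {t} → P t → P (suc t) →
                     (∀ {m} → t ≤ m → P m → P (2 + m)) → ∀ {m} → t ≤ m → P m
two-step-induction P {t} base base′ step {m} t≤m = subst P (m∸n+n≡m t≤m) (go (m ∸ t))
  where
  go : ∀ d → P (d + t)
  go zero          = base
  go (suc zero)    = base′
  go (suc (suc d)) = step (m≤n+m t d) (go d)

-- The induction from m to m + 2

module Growth (Δ : ℕ) (Δ≥3 : 3 ≤ Δ) where

  -- `f-step` produces powers of 2 + m, so the k Δ m arcs are written as k Δ (2 + m) minus 2 k Δ.
  -- That deficit and the loss of an insertion make up `c`; `threshold` is the size from which
  -- `small-loss` applies with exponent Δ.
  k T D c threshold : ℕ
  k = suc Δ
  T = #pairs k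
  D = Δ ! * Δ !
  c = loss Δ + 2 * (k * Δ)
  threshold = 3 * (Δ * c)

  -- f m is the upper bound of frozenGraphs-bound.
  f g : ℕ → ℕ
  f m = k ^ (k * m) * (m !) ^ T
  g m = #regular Δ (m * k)

  K : ℕ → ℕ
  K m = k * Δ * (2 + m) ∸ c

  module _ {m} (m≥ : threshold ≤ m) where
    open ≤-Reasoning

    private
      instance
        Δ≢0 : ℕ.NonZero Δ
        Δ≢0 = ℕ.>-nonZero (≤-trans (s≤s z≤n) Δ≥3)

      z : ℕ
      z = k * Δ * (2 + m)

      threshold≤z : threshold ≤ z
      threshold≤z = begin
        threshold       ≤⟨ m≥ ⟩
        m               ≤⟨ m≤n+m m 2 ⟩
        2 + m           ≤⟨ m≤n*m (2 + m) (k * Δ) {{m*n≢0 k Δ}} ⟩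
        k * Δ * (2 + m) ∎

      K+c≡z : K m + c ≡ z
      K+c≡z = m∸n+n≡m (≤-trans (≤-trans (m≤n*m c Δ) (m≤n*m (Δ * c) 3)) threshold≤z)

      z>0 : 0 < K m + c
      z>0 = subst (0 <_) (sym K+c≡z) (≤-trans (s≤s z≤n) (m≤n*m (2 + m) (k * Δ) {{m*n≢0 k Δ}}))

    K-admissible : K m + loss Δ ≤ m * k * Δ
    K-admissible = +-cancelʳ-≤ (2 * (k * Δ)) _ _ (≤-reflexive (trans (+-assoc (K m) (loss Δ) _) (trans K+c≡z
      (solve 3 (λ k Δ m → k :* Δ :* (con 2 :+ m) := m :* k :* Δ :+ con 2 :* (k :* Δ)) refl k Δ m))))

    -- The 3 of `entropy-gap` is split: 3/2 pays for replacing `z` by `K m`, and 2 stays as the gain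
    -- of one insertion.
    local-gap : 2 * (k * k * D * (2 + m) ^ Δ) ≤ K m ^ Δ
    local-gap = *-cancelˡ-≤ 3 (begin
      3 * (2 * (k * k * D * (2 + m) ^ Δ))
        ≡⟨ solve 3 (λ k f q → con 3 :* (con 2 :* (k :* k :* (f :* f) :* q)) := con 2 :* (con 3 :* (k :* f :* (k :* f)) :* q)) refl k (Δ !) ((2 + m) ^ Δ) ⟩
      2 * (3 * (k ! * k !) * (2 + m) ^ Δ)   ≤⟨ *-monoʳ-≤ 2 (*-monoˡ-≤ ((2 + m) ^ Δ) (entropy-gap Δ Δ≥3)) ⟩
      2 * ((k * Δ) ^ Δ * (2 + m) ^ Δ)       ≡⟨ cong (2 *_) (^-distribʳ-* Δ (k * Δ) (2 + m)) ⟨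
      2 * z ^ Δ                             ≡⟨ cong (λ t → 2 * t ^ Δ) K+c≡z ⟨
      2 * (K m + c) ^ Δ                     ≤⟨ small-loss (K m) c Δ z>0 (≤-trans threshold≤z (≤-reflexive (sym K+c≡z))) ⟩
      3 * K m ^ Δ                           ∎)

    g-step : g m * (K m ^ Δ) ^ k ≤ g (2 + m) * D ^ k
    g-step = subst (λ n → g m * (K m ^ Δ) ^ k ≤ #regular Δ n * D ^ k)
      (solve 2 (λ k m → k :* con 2 :+ m :* k := (con 2 :+ m) :* k) refl k m)
      (insertions-bound Δ (m * k) (K m) k K-admissible)

  -- Both new factors of (2 + m)! are bounded by 2 + m. As 2 T = k Δ, the growth becomes a k-th
  -- power, to be set against k insertions.
  f-step : ∀ m → f (2 + m) ≤ f m * (k * k * (2 + m) ^ Δ) ^ k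
  f-step m = begin
    k ^ (k * (2 + m)) * ((2 + m) * ((1 + m) * m !)) ^ T
      ≡⟨ cong₂ _*_ (trans (cong (k ^_) (solve 2 (λ k m → k :* (con 2 :+ m) := k :* m :+ (k :+ k)) refl k m)) (^-distribˡ-+-* k (k * m) (k + k)))
                   (trans (^-distribʳ-* T (2 + m) _) (cong ((2 + m) ^ T *_) (^-distribʳ-* T (1 + m) (m !)))) ⟩
    k ^ (k * m) * k ^ (k + k) * ((2 + m) ^ T * ((1 + m) ^ T * (m !) ^ T))
      ≤⟨ *-monoʳ-≤ (k ^ (k * m) * k ^ (k + k)) (*-monoʳ-≤ ((2 + m) ^ T) (*-monoˡ-≤ ((m !) ^ T) (^-monoˡ-≤ T (n≤1+n (1 + m))))) ⟩
    k ^ (k * m) * k ^ (k + k) * ((2 + m) ^ T * ((2 + m) ^ T * (m !) ^ T))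
      ≡⟨ solve 4 (λ a b c d → a :* b :* (c :* (c :* d)) := (a :* d) :* (b :* (c :* c))) refl (k ^ (k * m)) (k ^ (k + k)) ((2 + m) ^ T) ((m !) ^ T) ⟩
    f m * (k ^ (k + k) * ((2 + m) ^ T * (2 + m) ^ T))
      ≡⟨ cong (f m *_) (cong₂ _*_ (trans (^-distribˡ-+-* k k k) (sym (^-distribʳ-* k k k)))
           (trans (sym (^-distribˡ-+-* (2 + m) T T)) (trans (cong ((2 + m) ^_) (trans (double-#pairs Δ) (*-comm k Δ))) (sym (^-*-assoc (2 + m) Δ k))))) ⟩
    f m * ((k * k) ^ k * ((2 + m) ^ Δ) ^ k)
      ≡⟨ cong (f m *_) (^-distribʳ-* k (k * k) ((2 + m) ^ Δ)) ⟨
    f m * (k * k * (2 + m) ^ Δ) ^ k ∎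
    where open ≤-Reasoning

  4≤2^k : 4 ≤ 2 ^ k
  4≤2^k = ^-monoʳ-≤ 2 (≤-trans (n≤1+n 2) (≤-trans Δ≥3 (n≤1+n Δ)))

  -- The two additional factors 2 on the left are paid out of the gain 2^k of k insertions.
  step : ∀ {m A} → threshold ≤ m → f m * 2 ^ m ≤ A * g m → f (2 + m) * 2 ^ (2 + m) ≤ A * g (2 + m)
  step {m} {A} m≥ bound = *-cancelʳ-≤ _ _ (D ^ k) {{m^n≢0 D k {{m*n≢0 (Δ !) (Δ !) {{Δ !≢0}} {{Δ !≢0}}}}}} (begin
    f (2 + m) * (2 * (2 * 2 ^ m)) * D ^ k
      ≤⟨ *-monoˡ-≤ (D ^ k) (*-monoˡ-≤ (2 * (2 * 2 ^ m)) (f-step m)) ⟩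
    f m * Q ^ k * (2 * (2 * 2 ^ m)) * D ^ k
      ≡⟨ solve 4 (λ a q t d → a :* q :* (con 2 :* (con 2 :* t)) :* d := a :* t :* (con 4 :* (q :* d))) refl (f m) (Q ^ k) (2 ^ m) (D ^ k) ⟩
    f m * 2 ^ m * (4 * (Q ^ k * D ^ k))
      ≤⟨ *-monoʳ-≤ (f m * 2 ^ m) (*-monoˡ-≤ (Q ^ k * D ^ k) 4≤2^k) ⟩
    f m * 2 ^ m * (2 ^ k * (Q ^ k * D ^ k))
      ≡⟨ cong (f m * 2 ^ m *_) (trans (cong (2 ^ k *_) (sym (^-distribʳ-* k Q D))) (sym (^-distribʳ-* k 2 (Q * D)))) ⟩
    f m * 2 ^ m * (2 * (Q * D)) ^ k
      ≡⟨ cong (λ t → f m * 2 ^ m * (2 * t) ^ k) (solve 3 (λ k p d → k :* k :* p :* d := k :* k :* d :* p) refl k ((2 + m) ^ Δ) D) ⟩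
    f m * 2 ^ m * (2 * (k * k * D * (2 + m) ^ Δ)) ^ k
      ≤⟨ *-mono-≤ bound (^-monoˡ-≤ k (local-gap m≥)) ⟩
    A * g m * (K m ^ Δ) ^ k
      ≡⟨ *-assoc A (g m) _ ⟩
    A * (g m * (K m ^ Δ) ^ k)
      ≤⟨ *-monoʳ-≤ A (g-step m≥) ⟩
    A * (g (2 + m) * D ^ k)
      ≡⟨ *-assoc A (g (2 + m)) _ ⟨
    A * g (2 + m) * D ^ k ∎)
    where
    open ≤-Reasoning
    Q : ℕ
    Q = k * k * (2 + m) ^ Δ

  -- The sum dominates both base values, one for each parity of m.
  amplitude : ℕ
  amplitude = f threshold * 2 ^ threshold + f (suc threshold) * 2 ^ suc threshold

  private
    P : ℕ → Set
    P m = f m * 2 ^ m ≤ amplitude * g m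

    amplitude≤ : ∀ m → amplitude ≤ amplitude * g m
    amplitude≤ m = m≤m*n amplitude (g m) {{ℕ.>-nonZero {g m} (#regular>0 Δ m)}}

    base : P threshold
    base = ≤-trans (m≤m+n (f threshold * 2 ^ threshold) _) (amplitude≤ threshold)

    base′ : P (suc threshold)
    base′ = ≤-trans (m≤n+m _ (f threshold * 2 ^ threshold)) (amplitude≤ (suc threshold))

  growth : ∀ {m} → threshold ≤ m → f m * 2 ^ m ≤ amplitude * g m
  growth = two-step-induction P {threshold} base base′ (λ {m} → step {m} {amplitude})

-- Lower bound for the exponential function

open Exp (Algebra.Bundles.CommutativeRing.semiring ℚ.+-*-commutativeRing)
  using (^-homo-*; ^-assocʳ) renaming (_^_ to _^ℚ_)

-- `_/_` reduces to lowest terms, so identities of fractions are checked on unnormalised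
-- representatives, where they concern integers.
fromℕ-* : ∀ a b → fromℕ (a * b) ≡ fromℕ a ℚ.* fromℕ b
fromℕ-* a b = ℚ.toℚᵘ-injective (begin
  ℚ.toℚᵘ (fromℕ (a * b))                    ≈⟨ ℚ.toℚᵘ-fromℚᵘ (ℚᵘ.mkℚᵘ (ℤ.+ (a * b)) 0) ⟩
  ℚᵘ.mkℚᵘ (ℤ.+ (a * b)) 0                  ≡⟨ cong (λ i → ℚᵘ.mkℚᵘ i 0) (ℤ.pos-* a b) ⟩
  ℚᵘ.mkℚᵘ (ℤ.+ a) 0 ℚᵘ.* ℚᵘ.mkℚᵘ (ℤ.+ b) 0 ≈⟨ ℚᵘ.*-cong (ℚ.toℚᵘ-fromℚᵘ (ℚᵘ.mkℚᵘ (ℤ.+ a) 0)) (ℚ.toℚᵘ-fromℚᵘ (ℚᵘ.mkℚᵘ (ℤ.+ b) 0)) ⟨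
  ℚ.toℚᵘ (fromℕ a) ℚᵘ.* ℚ.toℚᵘ (fromℕ b)    ≈⟨ ℚ.toℚᵘ-homo-* (fromℕ a) (fromℕ b) ⟨
  ℚ.toℚᵘ (fromℕ a ℚ.* fromℕ b)               ∎)
  where open ℚᵘ.≃-Reasoning

fromℕ-suc : ∀ a → fromℕ (suc a) ≡ 1ℚ ℚ.+ fromℕ a
fromℕ-suc a = ℚ.toℚᵘ-injective (begin
  ℚ.toℚᵘ (fromℕ (suc a))                   ≈⟨ ℚ.toℚᵘ-fromℚᵘ (ℚᵘ.mkℚᵘ (ℤ.+ suc a) 0) ⟩
  ℚᵘ.mkℚᵘ (ℤ.+ suc a) 0                    ≡⟨ cong (λ i → ℚᵘ.mkℚᵘ (ℤ.+ 1 ℤ.+ i) 0) (ℤ.*-identityʳ (ℤ.+ a)) ⟨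
  ℚᵘ.1ℚᵘ ℚᵘ.+ ℚᵘ.mkℚᵘ (ℤ.+ a) 0            ≈⟨ ℚᵘ.+-congʳ ℚᵘ.1ℚᵘ (ℚ.toℚᵘ-fromℚᵘ (ℚᵘ.mkℚᵘ (ℤ.+ a) 0)) ⟨
  ℚ.toℚᵘ 1ℚ ℚᵘ.+ ℚ.toℚᵘ (fromℕ a)          ≈⟨ ℚ.toℚᵘ-homo-+ 1ℚ (fromℕ a) ⟨
  ℚ.toℚᵘ (1ℚ ℚ.+ fromℕ a)                  ∎)
  where open ℚᵘ.≃-Reasoning

fromℕ-mono-≤ : ∀ {a b} → a ≤ b → fromℕ a ℚ.≤ fromℕ b
fromℕ-mono-≤ {a} {b} a≤b = ℚ.toℚᵘ-cancel-≤ (begin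
  ℚ.toℚᵘ (fromℕ a)     ≃⟨ ℚ.toℚᵘ-fromℚᵘ (ℚᵘ.mkℚᵘ (ℤ.+ a) 0) ⟩
  ℚᵘ.mkℚᵘ (ℤ.+ a) 0   ≤⟨ ℚᵘ.*≤* (ℤ.*-monoʳ-≤-nonNeg (ℤ.+ 1) (ℤ.+≤+ a≤b)) ⟩
  ℚᵘ.mkℚᵘ (ℤ.+ b) 0   ≃⟨ ℚ.toℚᵘ-fromℚᵘ (ℚᵘ.mkℚᵘ (ℤ.+ b) 0) ⟨
  ℚ.toℚᵘ (fromℕ b)     ∎)
  where open ℚᵘ.≤-Reasoning

fromℕ≥0 : ∀ a → 0ℚ ℚ.≤ fromℕ a
fromℕ≥0 a = fromℕ-mono-≤ {0} {a} z≤n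

fraction-* : ∀ a d → ℤ.+ a ℚ./ suc d ℚ.* fromℕ (suc d) ≡ fromℕ a
fraction-* a d = ℚ.toℚᵘ-injective (begin
  ℚ.toℚᵘ (ℤ.+ a ℚ./ suc d ℚ.* fromℕ (suc d))
    ≈⟨ ℚ.toℚᵘ-homo-* (ℤ.+ a ℚ./ suc d) (fromℕ (suc d)) ⟩
  ℚ.toℚᵘ (ℤ.+ a ℚ./ suc d) ℚᵘ.* ℚ.toℚᵘ (fromℕ (suc d))
    ≈⟨ ℚᵘ.*-cong (ℚ.toℚᵘ-fromℚᵘ (ℚᵘ.mkℚᵘ (ℤ.+ a) d)) (ℚ.toℚᵘ-fromℚᵘ (ℚᵘ.mkℚᵘ (ℤ.+ suc d) 0)) ⟩
  ℚᵘ.mkℚᵘ (ℤ.+ a) d ℚᵘ.* ℚᵘ.mkℚᵘ (ℤ.+ suc d) 0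
    ≈⟨ ℚᵘ.*≡* (trans (ℤ.*-identityʳ (ℤ.+ a ℤ.* ℤ.+ suc d)) (cong (λ e → ℤ.+ a ℤ.* ℤ.+ e) (sym (*-identityʳ (suc d))))) ⟩
  ℚᵘ.mkℚᵘ (ℤ.+ a) 0
    ≈⟨ ℚ.toℚᵘ-fromℚᵘ (ℚᵘ.mkℚᵘ (ℤ.+ a) 0) ⟨
  ℚ.toℚᵘ (fromℕ a) ∎)
  where open ℚᵘ.≃-Reasoning

+-cancelʳ : ∀ {p q} r → p ℚ.+ r ℚ.≤ q ℚ.+ r → p ℚ.≤ q
+-cancelʳ {p} {q} r p+r≤q+r = subst₂ ℚ._≤_ (cancel p) (cancel q) (ℚ.+-monoˡ-≤ (ℚ.- r) p+r≤q+r)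
  where
  cancel : ∀ s → s ℚ.+ r ℚ.- r ≡ s
  cancel s = trans (ℚ.+-assoc s r (ℚ.- r)) (trans (cong (s ℚ.+_) (ℚ.+-inverseʳ r)) (ℚ.+-identityʳ s))

*-monoˡ : ∀ {p q r} → 0ℚ ℚ.≤ r → p ℚ.≤ q → r ℚ.* p ℚ.≤ r ℚ.* q
*-monoˡ {r = r} r≥0 = ℚ.*-monoˡ-≤-nonNeg r {{ℚ.nonNegative r≥0}}

*-monoʳ : ∀ {p q r} → 0ℚ ℚ.≤ r → p ℚ.≤ q → p ℚ.* r ℚ.≤ q ℚ.* r
*-monoʳ {r = r} r≥0 = ℚ.*-monoʳ-≤-nonNeg r {{ℚ.nonNegative r≥0}}

fromℕ-cancelʳ : ∀ {p q} d → p ℚ.* fromℕ (suc d) ℚ.≤ q ℚ.* fromℕ (suc d) → p ℚ.≤ q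
fromℕ-cancelʳ d = ℚ.*-cancelʳ-≤-pos (fromℕ (suc d))
  {{ℚ.positive (ℚ.<-≤-trans (ℚ.positive⁻¹ 1ℚ) (fromℕ-mono-≤ {1} {suc d} (s≤s z≤n)))}}

*-nonNeg : ∀ {p q} → 0ℚ ℚ.≤ p → 0ℚ ℚ.≤ q → 0ℚ ℚ.≤ p ℚ.* q
*-nonNeg {p} {q} p≥0 q≥0 = subst (ℚ._≤ p ℚ.* q) (ℚ.*-zeroʳ p) (*-monoˡ p≥0 q≥0)

^-nonNeg : ∀ {p} → 0ℚ ℚ.≤ p → ∀ n → 0ℚ ℚ.≤ p ^ℚ n
^-nonNeg p≥0 zero    = ℚ.nonNegative⁻¹ 1ℚ
^-nonNeg p≥0 (suc n) = *-nonNeg p≥0 (^-nonNeg p≥0 n)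

^-≤1 : ∀ {p} → 0ℚ ℚ.≤ p → p ℚ.≤ 1ℚ → ∀ n → p ^ℚ n ℚ.≤ 1ℚ
^-≤1 p≥0 p≤1 zero    = ℚ.≤-refl
^-≤1 {p} p≥0 p≤1 (suc n) = ℚ.≤-trans (*-monoˡ p≥0 (^-≤1 p≥0 p≤1 n)) (ℚ.≤-trans (ℚ.≤-reflexive (ℚ.*-identityʳ p)) p≤1)

^-monoˡ : ∀ {p q} → 0ℚ ℚ.≤ p → p ℚ.≤ q → ∀ n → p ^ℚ n ℚ.≤ q ^ℚ n
^-monoˡ p≥0 p≤q zero    = ℚ.≤-refl
^-monoˡ p≥0 p≤q (suc n) =
  ℚ.≤-trans (*-monoˡ p≥0 (^-monoˡ p≥0 p≤q n)) (*-monoʳ (^-nonNeg (ℚ.≤-trans p≥0 p≤q) n) p≤q)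

^-antimonoʳ : ∀ {p m n} → 0ℚ ℚ.≤ p → p ℚ.≤ 1ℚ → m ≤ n → p ^ℚ n ℚ.≤ p ^ℚ m
^-antimonoʳ {p} {m} {n} p≥0 p≤1 m≤n = begin
  p ^ℚ n                 ≡⟨ cong (p ^ℚ_) (m+[n∸m]≡n m≤n) ⟨
  p ^ℚ (m + (n ∸ m))     ≡⟨ ^-homo-* p m (n ∸ m) ⟩
  p ^ℚ m ℚ.* p ^ℚ (n ∸ m) ≤⟨ *-monoˡ (^-nonNeg p≥0 m) (^-≤1 p≥0 p≤1 (n ∸ m)) ⟩
  p ^ℚ m ℚ.* 1ℚ           ≡⟨ ℚ.*-identityʳ (p ^ℚ m) ⟩
  p ^ℚ m                 ∎
  where open ℚ.≤-Reasoning

-- With b = 1 - y this is (1 - y)^s ≥ 1 - s y, arranged so that only sums occur.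
bernoulliℚ : ∀ {b y} → 0ℚ ℚ.≤ b → b ℚ.≤ 1ℚ → 0ℚ ℚ.≤ y → b ℚ.+ y ≡ 1ℚ →
             ∀ s → 1ℚ ℚ.≤ b ^ℚ s ℚ.+ fromℕ s ℚ.* y
bernoulliℚ {b} {y} b≥0 b≤1 y≥0 b+y≡1 zero = ℚ.≤-reflexive (sym (trans (cong (1ℚ ℚ.+_) (ℚ.*-zeroˡ y)) (ℚ.+-identityʳ 1ℚ)))
bernoulliℚ {b} {y} b≥0 b≤1 y≥0 b+y≡1 (suc s) = begin
  1ℚ                                       ≡⟨ b+y≡1 ⟨
  b ℚ.+ y                                  ≡⟨ cong (ℚ._+ y) (ℚ.*-identityʳ b) ⟨
  b ℚ.* 1ℚ ℚ.+ y                           ≤⟨ ℚ.+-monoˡ-≤ y (*-monoˡ b≥0 (bernoulliℚ b≥0 b≤1 y≥0 b+y≡1 s)) ⟩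
  b ℚ.* (b ^ℚ s ℚ.+ fromℕ s ℚ.* y) ℚ.+ y   ≡⟨ cong (ℚ._+ y) (ℚ.*-distribˡ-+ b (b ^ℚ s) (fromℕ s ℚ.* y)) ⟩
  b ℚ.* b ^ℚ s ℚ.+ b ℚ.* (fromℕ s ℚ.* y) ℚ.+ y
    ≤⟨ ℚ.+-monoˡ-≤ y (ℚ.+-monoʳ-≤ (b ^ℚ suc s) (*-monoʳ (*-nonNeg (fromℕ≥0 s) y≥0) b≤1)) ⟩
  b ^ℚ suc s ℚ.+ 1ℚ ℚ.* (fromℕ s ℚ.* y) ℚ.+ y
    ≡⟨ ℚ.+-*-Solver.solve 3 (λ q s y → q ⊕ Κ ⊗ (s ⊗ y) ⊕ y ⊜ q ⊕ (Κ ⊕ s) ⊗ y) refl (b ^ℚ suc s) (fromℕ s) y ⟩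
  b ^ℚ suc s ℚ.+ (1ℚ ℚ.+ fromℕ s) ℚ.* y    ≡⟨ cong (λ t → b ^ℚ suc s ℚ.+ t ℚ.* y) (fromℕ-suc s) ⟨
  b ^ℚ suc s ℚ.+ fromℕ (suc s) ℚ.* y       ∎
  where
  open ℚ.≤-Reasoning
  open ℚ.+-*-Solver using () renaming (_:+_ to _⊕_; _:*_ to _⊗_; _:=_ to _⊜_)
  Κ : ∀ {n} → ℚ.+-*-Solver.Polynomial n
  Κ = ℚ.+-*-Solver.con 1ℚ

-- Bernoulli's inequality, applied to (1 - x/M)^s with s = ⌊2M/h⌋, bounds each
-- of the h blocks of s factors of (1 - x/M)^M from below by ½.
½^-≤exp : ∀ {p x} h .{{_ : ℕ.NonZero h}} → 0ℚ ℚ.≤ x → x ℚ.* fromℕ 8 ℚ.≤ fromℕ (2 * h) →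
          p ℚ.≤ ½ ^ℚ h → p ≤exp (ℚ.- x)
½^-≤exp {p} {x} h x≥0 8x≤2h p≤ ε ε>0 = h , λ j h≤j → begin
  p                       ≤⟨ p≤ ⟩
  ½ ^ℚ h                  ≤⟨ power j (≤-trans h≤j (n≤1+n j)) ⟩
  expSeq (ℚ.- x) j        ≡⟨ ℚ.+-identityʳ (expSeq (ℚ.- x) j) ⟨
  expSeq (ℚ.- x) j ℚ.+ 0ℚ ≤⟨ ℚ.+-monoʳ-≤ (expSeq (ℚ.- x) j) (ℚ.<⇒≤ ε>0) ⟩
  expSeq (ℚ.- x) j ℚ.+ ε  ∎
  where
  open ℚ.≤-Reasoning
  power : ∀ j → h ≤ suc j → ½ ^ℚ h ℚ.≤ expSeq (ℚ.- x) j
  power j h≤M = begin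
    ½ ^ℚ h          ≤⟨ ^-monoˡ (ℚ.nonNegative⁻¹ ½) ½≤β^s h ⟩
    (β ^ℚ s) ^ℚ h   ≡⟨ ^-assocʳ β s h ⟩
    β ^ℚ (s * h)    ≤⟨ ^-antimonoʳ β≥0 β≤1 M≤s*h ⟩
    β ^ℚ M          ∎
    where
    M s : ℕ
    M = suc j
    s = (2 * M) ℕ./ h
    t δ β : ℚ
    t = ℤ.+ 1 ℚ./ M
    δ = x ℚ.* t
    β = 1ℚ ℚ.+ ℚ.- x ℚ.* t
    t*M≡1 : t ℚ.* fromℕ M ≡ 1ℚ
    t*M≡1 = fraction-* 1 j
    t≥0 : 0ℚ ℚ.≤ t
    t≥0 = fromℕ-cancelʳ j (ℚ.≤-trans (ℚ.≤-reflexive (ℚ.*-zeroˡ (fromℕ M)))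
      (ℚ.≤-trans (ℚ.nonNegative⁻¹ 1ℚ) (ℚ.≤-reflexive (sym t*M≡1))))
    δ≥0 : 0ℚ ℚ.≤ δ
    δ≥0 = *-nonNeg x≥0 t≥0
    β+δ≡1 : β ℚ.+ δ ≡ 1ℚ
    β+δ≡1 = solveℚ 2 (λ x t → (conℚ 1ℚ ⊕ ⊝ x ⊗ t) ⊕ x ⊗ t ⊜ conℚ 1ℚ) refl x t
      where open ℚ.+-*-Solver using () renaming (_:+_ to _⊕_; _:*_ to _⊗_; _:=_ to _⊜_; :-_ to ⊝_; solve to solveℚ; con to conℚ)
    s*h≤2M : s * h ≤ 2 * M
    s*h≤2M = m/n*n≤m (2 * M) h
    -- The remainder of 2 M by h is below h ≤ M, so rounding down costs at most half of 2 M.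
    M≤s*h : M ≤ s * h
    M≤s*h = +-cancelˡ-≤ M _ _ (≤-trans (≤-reflexive (trans (cong (M +_) (sym (+-identityʳ M))) (m≡m%n+[m/n]*n (2 * M) h)))
      (+-monoˡ-≤ (s * h) (≤-trans (<⇒≤ (m%n<n (2 * M) h)) h≤M)))
    -- The hypothesis says x ≤ h / 4. Hence s δ ≤ (2 M / h) (x / M) ≤ 1/2, which is the case c = 2;
    -- the case c = 1 gives δ ≤ 1/4.
    scaled : ∀ a {c} → a * h ≤ c * M → fromℕ a ℚ.* δ ℚ.* fromℕ 8 ℚ.≤ fromℕ (2 * c)
    scaled a {c} ah≤cM = begin
      fromℕ a ℚ.* (x ℚ.* t) ℚ.* fromℕ 8   ≡⟨ solveℚ 4 (λ a x t e → a ⊗ (x ⊗ t) ⊗ e ⊜ a ⊗ (x ⊗ e) ⊗ t) refl (fromℕ a) x t (fromℕ 8) ⟩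
      fromℕ a ℚ.* (x ℚ.* fromℕ 8) ℚ.* t   ≤⟨ *-monoʳ t≥0 (*-monoˡ (fromℕ≥0 a) 8x≤2h) ⟩
      fromℕ a ℚ.* fromℕ (2 * h) ℚ.* t     ≡⟨ cong (ℚ._* t) (fromℕ-* a (2 * h)) ⟨
      fromℕ (a * (2 * h)) ℚ.* t           ≤⟨ *-monoʳ t≥0 (fromℕ-mono-≤ a2h≤2cM) ⟩
      fromℕ (2 * c * M) ℚ.* t             ≡⟨ cong (ℚ._* t) (fromℕ-* (2 * c) M) ⟩
      fromℕ (2 * c) ℚ.* fromℕ M ℚ.* t     ≡⟨ solveℚ 3 (λ c m t → c ⊗ m ⊗ t ⊜ c ⊗ (t ⊗ m)) refl (fromℕ (2 * c)) (fromℕ M) t ⟩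
      fromℕ (2 * c) ℚ.* (t ℚ.* fromℕ M)   ≡⟨ cong (fromℕ (2 * c) ℚ.*_) t*M≡1 ⟩
      fromℕ (2 * c) ℚ.* 1ℚ                ≡⟨ ℚ.*-identityʳ (fromℕ (2 * c)) ⟩
      fromℕ (2 * c)                       ∎
      where
      open ℚ.+-*-Solver using () renaming (_:*_ to _⊗_; _:=_ to _⊜_; solve to solveℚ)
      a2h≤2cM : a * (2 * h) ≤ 2 * c * M
      a2h≤2cM = ≤-trans (≤-reflexive (solve 2 (λ a h → a :* (con 2 :* h) := con 2 :* (a :* h)) refl a h))
        (≤-trans (*-monoʳ-≤ 2 ah≤cM) (≤-reflexive (sym (*-assoc 2 c M))))
    δ≤1 : δ ℚ.≤ 1ℚ
    δ≤1 = fromℕ-cancelʳ 7 (ℚ.≤-trans (ℚ.≤-reflexive (cong (ℚ._* fromℕ 8) (sym (ℚ.*-identityˡ δ))))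
      (ℚ.≤-trans (scaled 1 {1} (*-monoʳ-≤ 1 h≤M)) (fromℕ-mono-≤ {2} {8} (s≤s (s≤s z≤n)))))
    sδ≤½ : fromℕ s ℚ.* δ ℚ.≤ ½
    sδ≤½ = fromℕ-cancelʳ 7 (scaled s {2} s*h≤2M)
    β≥0 : 0ℚ ℚ.≤ β
    β≥0 = +-cancelʳ δ (subst₂ ℚ._≤_ (sym (ℚ.+-identityˡ δ)) (sym β+δ≡1) δ≤1)
    β≤1 : β ℚ.≤ 1ℚ
    β≤1 = ℚ.≤-trans (ℚ.≤-reflexive (sym (ℚ.+-identityʳ β)))
      (ℚ.≤-trans (ℚ.+-monoʳ-≤ β δ≥0) (ℚ.≤-reflexive β+δ≡1))
    ½≤β^s : ½ ℚ.≤ β ^ℚ s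
    ½≤β^s = +-cancelʳ ½ (ℚ.≤-trans (bernoulliℚ β≥0 β≤1 δ≥0 β+δ≡1 s) (ℚ.+-monoʳ-≤ (β ^ℚ s) sδ≤½))

-- From counts to probabilities

½^-2^ : ∀ h → ½ ^ℚ h ℚ.* fromℕ (2 ^ h) ≡ 1ℚ
½^-2^ zero    = refl
½^-2^ (suc h) = begin
  ½ ℚ.* ½ ^ℚ h ℚ.* fromℕ (2 * 2 ^ h)             ≡⟨ cong (½ ℚ.* ½ ^ℚ h ℚ.*_) (fromℕ-* 2 (2 ^ h)) ⟩
  ½ ℚ.* ½ ^ℚ h ℚ.* (fromℕ 2 ℚ.* fromℕ (2 ^ h))
    ≡⟨ ℚ.+-*-Solver.solve 2 (λ p q → con½ ⊗ p ⊗ (con2 ⊗ q) ⊜ p ⊗ q) refl (½ ^ℚ h) (fromℕ (2 ^ h)) ⟩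
  ½ ^ℚ h ℚ.* fromℕ (2 ^ h)                        ≡⟨ ½^-2^ h ⟩
  1ℚ                                              ∎
  where
  open ≡-Reasoning
  open ℚ.+-*-Solver using () renaming (_:*_ to _⊗_; _:=_ to _⊜_)
  con½ con2 : ∀ {n} → ℚ.+-*-Solver.Polynomial n
  con½ = ℚ.+-*-Solver.con ½
  con2 = ℚ.+-*-Solver.con (fromℕ 2)

ℙ≤½^ : ∀ {a p} {A : Set a} {P : Pred A p} (P? : Decidable P) xs h →
       length (filter P? xs) * 2 ^ h ≤ length xs → ℙ[ P? over xs ] ℚ.≤ ½ ^ℚ h
-- Over the empty list the probability is 0 by convention.
ℙ≤½^ P? []           h _     = ^-nonNeg (ℚ.nonNegative⁻¹ ½) h
ℙ≤½^ P? xs@(_ ∷ ys) h bound = fromℕ-cancelʳ (length ys) (begin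
  ℤ.+ r ℚ./ length xs ℚ.* fromℕ (length xs)       ≡⟨ fraction-* r (length ys) ⟩
  fromℕ r                                         ≡⟨ ℚ.*-identityʳ (fromℕ r) ⟨
  fromℕ r ℚ.* 1ℚ                                  ≡⟨ cong (fromℕ r ℚ.*_) (½^-2^ h) ⟨
  fromℕ r ℚ.* (½ ^ℚ h ℚ.* fromℕ (2 ^ h))
    ≡⟨ ℚ.+-*-Solver.solve 3 (λ r p q → r ⊗ (p ⊗ q) ⊜ p ⊗ (r ⊗ q)) refl (fromℕ r) (½ ^ℚ h) (fromℕ (2 ^ h)) ⟩
  ½ ^ℚ h ℚ.* (fromℕ r ℚ.* fromℕ (2 ^ h))          ≡⟨ cong (½ ^ℚ h ℚ.*_) (fromℕ-* r (2 ^ h)) ⟨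
  ½ ^ℚ h ℚ.* fromℕ (r * 2 ^ h)                    ≤⟨ *-monoˡ (^-nonNeg (ℚ.nonNegative⁻¹ ½) h) (fromℕ-mono-≤ bound) ⟩
  ½ ^ℚ h ℚ.* fromℕ (length xs)                    ∎)
  where
  open ℚ.≤-Reasoning
  open ℚ.+-*-Solver using () renaming (_:*_ to _⊗_; _:=_ to _⊜_)
  r : ℕ
  r = length (filter P? xs)

n<2^n : ∀ n → n < 2 ^ n
n<2^n zero    = s≤s z≤n
n<2^n (suc n) = +-mono-≤ (≤-trans (s≤s z≤n) (n<2^n n)) (≤-trans (n<2^n n) (m≤m+n (2 ^ n) 0))

module Decay (Δ : ℕ) (Δ≥3 : 3 ≤ Δ) where

  open Growth Δ Δ≥3

  -- For n = k m the exponent is m / 8. It has to stay below h / 4 with h = m - `amplitude`, which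
  -- holds once h ≥ m / 2.
  rate : ℚ
  rate = ℤ.+ 1 ℚ./ (8 * k)

  rate>0 : 0ℚ ℚ.< rate
  rate>0 = ℚ.positive⁻¹ rate {{ℚ.normalize-pos 1 (8 * k)}}

  -- For n = k m this forces m ≥ `threshold`, where the growth bound starts, and m > 2 `amplitude`,
  -- so that more than half of the m halvings survive.
  n₀ : ℕ
  n₀ = k * (threshold + suc (2 * amplitude))

  rate-scaled : ∀ n h → n * 8 ≤ 2 * h * (8 * k) → rate ℚ.* fromℕ n ℚ.* fromℕ 8 ℚ.≤ fromℕ (2 * h)
  rate-scaled n h bound = fromℕ-cancelʳ (Δ + 7 * k) (begin
    rate ℚ.* fromℕ n ℚ.* fromℕ 8 ℚ.* fromℕ (8 * k)
      ≡⟨ ℚ.+-*-Solver.solve 4 (λ c n e d → c ⊗ n ⊗ e ⊗ d ⊜ (c ⊗ d) ⊗ (n ⊗ e)) refl rate (fromℕ n) (fromℕ 8) (fromℕ (8 * k)) ⟩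
    rate ℚ.* fromℕ (8 * k) ℚ.* (fromℕ n ℚ.* fromℕ 8)
      ≡⟨ cong₂ ℚ._*_ (fraction-* 1 (Δ + 7 * k)) (sym (fromℕ-* n 8)) ⟩
    1ℚ ℚ.* fromℕ (n * 8)                ≡⟨ ℚ.*-identityˡ (fromℕ (n * 8)) ⟩
    fromℕ (n * 8)                       ≤⟨ fromℕ-mono-≤ bound ⟩
    fromℕ (2 * h * (8 * k))             ≡⟨ fromℕ-* (2 * h) (8 * k) ⟩
    fromℕ (2 * h) ℚ.* fromℕ (8 * k)     ∎)
    where
    open ℚ.≤-Reasoning
    open ℚ.+-*-Solver using () renaming (_:*_ to _⊗_; _:=_ to _⊜_)

  decay-from : ∀ n h .{{_ : ℕ.NonZero h}} → n * 8 ≤ 2 * h * (8 * k) →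
               length (frozenGraphs Δ n) * 2 ^ h ≤ #regular Δ n →
               ℙ[ hasFrozenColouring? k over regularGraphs Δ n ] ≤exp (ℚ.- (rate ℚ.* fromℕ n))
  decay-from n h scaled bound = ½^-≤exp h (*-nonNeg (ℚ.<⇒≤ rate>0) (fromℕ≥0 n)) (rate-scaled n h scaled)
    (ℙ≤½^ (hasFrozenColouring? k) (regularGraphs Δ n) h bound)

  -- The constant `amplitude` is absorbed into the exponent through `amplitude` ≤ 2^`amplitude`, at
  -- the price of that many halvings.
  frozen-rare : ∀ m → threshold ≤ m → amplitude ≤ m →
                length (frozenGraphs Δ (k * m)) * 2 ^ (m ∸ amplitude) ≤ #regular Δ (k * m)
  frozen-rare m t≤m a≤m = *-cancelʳ-≤ _ _ (2 ^ amplitude) {{m^n≢0 2 amplitude}} (begin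
    length (frozenGraphs Δ (k * m)) * 2 ^ h * 2 ^ amplitude
      ≡⟨ *-assoc (length (frozenGraphs Δ (k * m))) (2 ^ h) (2 ^ amplitude) ⟩
    length (frozenGraphs Δ (k * m)) * (2 ^ h * 2 ^ amplitude)
      ≡⟨ cong (length (frozenGraphs Δ (k * m)) *_) (trans (sym (^-distribˡ-+-* 2 h amplitude)) (cong (2 ^_) (m∸n+n≡m a≤m))) ⟩
    length (frozenGraphs Δ (k * m)) * 2 ^ m  ≤⟨ *-monoˡ-≤ (2 ^ m) (frozenGraphs-bound Δ m) ⟩
    f m * 2 ^ m                              ≤⟨ growth t≤m ⟩
    amplitude * g m                          ≤⟨ *-monoˡ-≤ (g m) (<⇒≤ (n<2^n amplitude)) ⟩
    2 ^ amplitude * g m                      ≡⟨ *-comm (2 ^ amplitude) (g m) ⟩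
    g m * 2 ^ amplitude                      ≡⟨ cong (λ n → #regular Δ n * 2 ^ amplitude) (*-comm m k) ⟩
    #regular Δ (k * m) * 2 ^ amplitude       ∎)
    where
    open ≤-Reasoning
    h : ℕ
    h = m ∸ amplitude

  decay-divisible : ∀ m → n₀ ≤ k * m →
                    ℙ[ hasFrozenColouring? k over regularGraphs Δ (k * m) ] ≤exp (ℚ.- (rate ℚ.* fromℕ (k * m)))
  decay-divisible m n₀≤ = decay-from (k * m) h {{ℕ.>-nonZero h>0}} scaled (frozen-rare m t≤m a≤m)
    where
    open ≤-Reasoning
    h : ℕ
    h = m ∸ amplitude
    m≥ : threshold + suc (2 * amplitude) ≤ m
    m≥ = *-cancelˡ-≤ k n₀≤
    t≤m : threshold ≤ m
    t≤m = m+n≤o⇒m≤o threshold m≥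
    2a<m : suc (2 * amplitude) ≤ m
    2a<m = m+n≤o⇒n≤o threshold m≥
    a≤m : amplitude ≤ m
    a≤m = ≤-trans (m≤n*m amplitude 2) (<⇒≤ 2a<m)
    a<h : amplitude < h
    a<h = m+n≤o⇒m≤o∸n (suc amplitude)
      (≤-trans (≤-reflexive (cong (λ t → suc (amplitude + t)) (sym (+-identityʳ amplitude)))) 2a<m)
    h>0 : 0 < h
    h>0 = ≤-trans (s≤s z≤n) a<h
    m≤2h : m ≤ 2 * h
    m≤2h = begin
      m               ≡⟨ m∸n+n≡m a≤m ⟨
      h + amplitude   ≤⟨ +-monoʳ-≤ h (≤-trans (<⇒≤ a<h) (m≤m+n h 0)) ⟩
      2 * h           ∎
    scaled : k * m * 8 ≤ 2 * h * (8 * k)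
    scaled = begin
      k * m * 8         ≡⟨ solve 2 (λ k m → k :* m :* con 8 := m :* (con 8 :* k)) refl k m ⟩
      m * (8 * k)       ≤⟨ *-monoˡ-≤ (8 * k) m≤2h ⟩
      2 * h * (8 * k)   ∎

  n₀>0 : 0 < n₀
  n₀>0 = ≤-trans (≤-trans (s≤s z≤n) (m≤n+m (suc (2 * amplitude)) threshold)) (m≤n*m _ k)

  -- The case split is on the list of frozen graphs instead of on divisibility: a single frozen
  -- graph already forces k to divide n.
  decay : ∀ n → n₀ ≤ n →
          ℙ[ hasFrozenColouring? k over regularGraphs Δ n ] ≤exp (ℚ.- (rate ℚ.* fromℕ n))
  decay n n₀≤n with frozenGraphs Δ n in eq
  -- With no frozen graph every exponent is admissible; h = n is large enough for the rate.
  ... | [] = decay-from n n {{ℕ.>-nonZero (≤-trans n₀>0 n₀≤n)}}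
    (≤-trans (≤-reflexive (*-comm n 8)) (≤-trans (*-monoˡ-≤ n (m≤m*n 8 k)) (≤-trans (≤-reflexive (*-comm (8 * k) n)) (*-monoˡ-≤ (8 * k) (m≤n*m n 2)))))
    (subst (λ xs → length xs * 2 ^ n ≤ #regular Δ n) (sym eq) z≤n)
  ... | G ∷ _ with m , refl ← ∈-frozenGraphs⇒divisible {Δ} {n} {G} (subst (G ∈_) (sym eq) (here refl)) =
    decay-divisible m n₀≤n

proposition6 : ∀ (Δ : ℕ) → 3 ℕ.≤ Δ →
    ∃[ c ] ∃[ n₀ ] (0ℚ ℚ.< c × 0 ℕ.< n₀ ×
    (∀ (n : ℕ) → n₀ ℕ.≤ n → 2 ∣ Δ ℕ.* n →
    ℙ[ hasFrozenColouring? (suc Δ) over regularGraphs Δ n ] ≤exp (ℚ.- (c ℚ.* fromℕ n))))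
proposition6 Δ Δ≥3 = rate , n₀ , rate>0 , n₀>0 , λ n n₀≤n _ → decay n n₀≤n
  where open Decay Δ Δ≥3
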